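{- Let $q$ be a complex number with $|q|<1$. Then the following four identities hold: \begin{align*} &\sum_{n,m\geq 0}\frac{(-1)^{\binom{n-m}{2}}q^{\frac{3m^2}{4}+\frac{mn}{2}+\frac{3n^2}{4}}}{(q;q)_m(q;q)_n}=\frac{1}{\bigl(q^2,q^8;q^{10}\bigr)_{\infty}},\\ &\sum_{n,m\geq 0}\frac{(-1)^{\binom{n-m}{2}}q^{\frac{3m^2}{4}+\frac{mn}{2}+\frac{3n^2}{4}+m+n}}{(q;q)_m(q;q)_n}=\frac{1}{\bigl(q^4,q^6;q^{10}\bigr)_{\infty}},\\ &\sum_{n,m\geq 0}\frac{(-1)^mq^{\frac{m^2}{4}+\frac{mn}{2}+\frac{n^2}{4}}}{\bigl(q^2;q^2\bigr)_m\bigl(q^2;q^2\bigr)_n} =\frac{1}{\bigl(-q^2;q^2\bigr)_{\infty}\bigl(q,q^4;q^5\bigr)_{\infty}},\\ &\sum_{n,m\geq 0}\frac{(-1)^mq^{\frac{m^2}{4}+\frac{mn}{2}+\frac{n^2}{4}+m+n}}{\bigl(q^2;q^2\bigr)_m\bigl(q^2;q^2\bigr)_n} =\frac{1}{\bigl(-q^2;q^2\bigr)_{\infty}\bigl(q^2,q^3;q^5\bigr)_{\infty}}, \end{align*} where the sums run over all pairs of nonnegative integers $(n,m)$.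
   Context: Standard $q$-Pochhammer notation: $(a;q)_0=1$, $(a;q)_n=\prod_{k=0}^{n-1}(1-aq^k)$ for $n\ge1$, $(a;q)_\infty=\prod_{k=0}^{\infty}(1-aq^k)$, and $(a_1,\dots,a_m;q)_n=(a_1;q)_n\cdots(a_m;q)_n$ for $n\in\mathbb{N}\cup\{\infty\}$. For an integer $k$ (possibly negative), $\binom{k}{2}=k(k-1)/2$. Fractional powers of $q$ are taken with respect to a fixed choice of $q^{1/4}$ (with $q^{a/4}=(q^{1/4})^a$ for integers $a$); equivalently the identities may be read as identities of formal power series in $q^{1/4}$. -}

module Defs where

-- Formal power series in t = q^(1/4) with integer coefficients.
-- (The identities are read as identities of formal power series in q^(1/4),
--  as permitted by the context; q = t^4.)

open import Data.Nat as ℕ using (ℕ; zero; suc; _∸_; _≡ᵇ_)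
open import Data.Integer as ℤ using (ℤ; +_; -[1+_])
open import Data.List using (List; []; _∷_; map; zipWith; upTo; length; foldr)
open import Data.Bool using (if_then_else_)
open import Data.Product using (_×_)
open import Relation.Binary.PropositionalEquality using (_≡_)

Series : Set
Series = ℕ → ℤ

sumZ : List ℤ → ℤ
sumZ = foldr ℤ._+_ (ℤ.+ 0)

_≐_ : Series → Series → Set
f ≐ g = ∀ N → f N ≡ g N

infix 4 _≐_

oneS : Series
oneS zero = ℤ.+ 1
oneS (suc _) = ℤ.+ 0

mono : ℤ → ℕ → Series
mono c e k = if k ≡ᵇ e then c else ℤ.+ 0

_+S_ : Series → Series → Series
(f +S g) k = f k ℤ.+ g k

_*S_ : Series → Series → Series
(f *S g) n = sumZ (map (λ i → f i ℤ.* g (n ∸ i)) (upTo (suc n)))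

infixl 6 _+S_
infixl 7 _*S_

-- Multiplicative inverse of a series with constant term 1:
-- b_0 = 1, b_n = - Σ_{k=1}^{n} a_k b_{n-k}.
-- invRev f n = [b_n, b_{n-1}, ..., b_0]
invRev : Series → ℕ → List ℤ
invRev f zero = ℤ.+ 1 ∷ []
invRev f (suc n) =
  let L = invRev f n in
  ℤ.- sumZ (zipWith ℤ._*_ (map (λ i → f (suc i)) (upTo (length L))) L) ∷ L

headZ : List ℤ → ℤ
headZ [] = ℤ.+ 0
headZ (x ∷ _) = x

invS : Series → Series
invS f n = headZ (invRev f n)

oneMinus : ℤ → ℕ → Series
oneMinus c e = oneS +S mono (ℤ.- c) e

poch : ℤ → ℕ → ℕ → ℕ → Series
poch c e s zero = oneS
poch c e s (suc n) = poch c e s n *S oneMinus c (e ℕ.+ s ℕ.* n)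

-- infinite q-Pochhammer (c t^e ; t^s)_∞, for e ≥ 1, s ≥ 1 (formal limit):
-- the coefficient of t^N only depends on the factors with k ≤ N.
pochInf : ℤ → ℕ → ℕ → Series
pochInf c e s N = poch c e s (suc N) N

-- Double sum Σ_{n,m ≥ 0} T n m of series where T n m has t-adic order
-- ≥ max(n,m) (true for all four sums below): coefficient of t^N is the
-- finite sum over n, m ≤ N.
doubleSum : (ℕ → ℕ → Series) → Series
doubleSum T N = sumZ (map (λ n → sumZ (map (λ m → T n m N) (upTo (suc N)))) (upTo (suc N)))

-- binom(k,2) = k(k-1)/2 for integer k (always a natural number)
binom2 : ℤ → ℕ
binom2 (+ d) = (d ℕ.* (d ∸ 1)) ℕ./ 2
binom2 -[1+ j ] = (suc j ℕ.* suc (suc j)) ℕ./ 2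

sgn : ℕ → ℤ
sgn k = (ℤ.- ℤ.+ 1) ℤ.^ k

-- (q;q)_m with q = t^4, and (q²;q²)_m with q² = t^8
qq : ℕ → Series
qq m = poch (ℤ.+ 1) 4 4 m

q2q2 : ℕ → Series
q2q2 m = poch (ℤ.+ 1) 8 8 m

-- Left-hand sides (exponents of q multiplied by 4 to get exponents of t)
lhs1 lhs2 lhs3 lhs4 : Series
lhs1 = doubleSum λ n m →
  mono (sgn (binom2 (+ n ℤ.- + m))) (3 ℕ.* m ℕ.* m ℕ.+ 2 ℕ.* m ℕ.* n ℕ.+ 3 ℕ.* n ℕ.* n)
    *S invS (qq m) *S invS (qq n)
lhs2 = doubleSum λ n m →
  mono (sgn (binom2 (+ n ℤ.- + m)))
       (3 ℕ.* m ℕ.* m ℕ.+ 2 ℕ.* m ℕ.* n ℕ.+ 3 ℕ.* n ℕ.* n ℕ.+ 4 ℕ.* m ℕ.+ 4 ℕ.* n)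
    *S invS (qq m) *S invS (qq n)
lhs3 = doubleSum λ n m →
  mono (sgn m) (m ℕ.* m ℕ.+ 2 ℕ.* m ℕ.* n ℕ.+ n ℕ.* n)
    *S invS (q2q2 m) *S invS (q2q2 n)
lhs4 = doubleSum λ n m →
  mono (sgn m) (m ℕ.* m ℕ.+ 2 ℕ.* m ℕ.* n ℕ.+ n ℕ.* n ℕ.+ 4 ℕ.* m ℕ.+ 4 ℕ.* n)
    *S invS (q2q2 m) *S invS (q2q2 n)

rhs1 rhs2 rhs3 rhs4 : Series
rhs1 = invS (pochInf (ℤ.+ 1) 8 40 *S pochInf (ℤ.+ 1) 32 40)
rhs2 = invS (pochInf (ℤ.+ 1) 16 40 *S pochInf (ℤ.+ 1) 24 40)
rhs3 = invS (pochInf (ℤ.- ℤ.+ 1) 8 8 *S (pochInf (ℤ.+ 1) 4 20 *S pochInf (ℤ.+ 1) 16 20))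
rhs4 = invS (pochInf (ℤ.- ℤ.+ 1) 8 8 *S (pochInf (ℤ.+ 1) 8 20 *S pochInf (ℤ.+ 1) 12 20))

{-# OPTIONS --safe #-}
module Submission where

-- For n + m odd the terms of the first two sums cancel in pairs, and for n + m = 2s the inner sum
-- is a Bailey pair with β_s = 1/(q²;q²)_s, obtained from Gauss' evaluation of Σ (−1)ⁱ/((q)_i (q)_(k−i))
-- by one Bailey step.  The first two sums are thus the Rogers–Ramanujan sums in q².  In the last two,
-- Gauss' evaluation directly leaves Σ q^(s²)/(q⁴;q⁴)_s and Σ q^(s²+2s)/(q⁴;q⁴)_s, and multiplying
-- by (−q²;q²)_∞ turns these into the Rogers–Ramanujan sums in q, because
-- Σ_k q^k/((q²;q²)_k (q²;q²)_(n−k)) = 1/(q;q)_n.  The Rogers–Ramanujan identities follow from two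
-- Bailey steps applied to the unit Bailey pairs and from the Jacobi triple product.
--
-- All of this is done exactly at a finite level N, over an arbitrary commutative ring; the passage
-- to infinite sums and products is a congruence modulo t^N.

open import Defs
open import Algebra.Bundles using (CommutativeRing)
open import Algebra.Solver.Ring.AlmostCommutativeRing using (fromCommutativeRing; _-Raw-AlmostCommutative⟶_)
open import Data.Bool.Base using (true; false)
open import Data.Integer.Base as ℤ using (ℤ; +_; -[1+_])
import Data.Integer.Properties as ℤₚ
open import Data.Integer.Tactic.RingSolver using () renaming (solve-∀ to solve-∀ᶻ)
open import Data.List.Base using ([]; _∷_; map; zipWith; upTo; applyUpTo; length)
import Data.Maybe.Base as Maybe
open import Data.Nat.Base as ℕ using (ℕ; zero; suc; _≡ᵇ_)
open import Data.Nat.DivMod using (m*n/n≡m)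
import Data.Nat.Properties as ℕₚ
open import Data.Nat.Tactic.RingSolver using (solve-∀)
open import Data.Product using (_×_; _,_)
open import Function.Base using (_∘_)
open import Level using (0ℓ)
open import Relation.Binary.PropositionalEquality as ≡ using (_≡_)
open import Relation.Nullary.Decidable using (dec⇒maybe)

module IntegerCoefficients (R : CommutativeRing 0ℓ 0ℓ) where
  open CommutativeRing R renaming (zero to *-zero)
  open import Algebra.Properties.Ring ring
  open import Algebra.Properties.AbelianGroup +-abelianGroup using (⁻¹-∙-comm)
  open import Algebra.Properties.Semiring.Mult.TCOptimised semiring renaming (_×_ to _·_)
  open import Relation.Binary.Reasoning.Setoid setoid

  private
    ⟦_⟧ℤ : ℤ → Carrier
    ⟦ + n ⟧ℤ = n · 1#
    ⟦ -[1+ n ] ⟧ℤ = - (suc n · 1#)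

    ⟦-⟧ : ∀ z → ⟦ ℤ.- z ⟧ℤ ≈ - ⟦ z ⟧ℤ
    ⟦-⟧ (+ zero) = sym -0#≈0#
    ⟦-⟧ (+ suc n) = refl
    ⟦-⟧ -[1+ n ] = sym (-‿involutive _)

    ⟦⊖⟧ : ∀ m n → ⟦ m ℤ.⊖ n ⟧ℤ ≈ m · 1# - n · 1#
    ⟦⊖⟧ zero zero = sym (-‿inverseʳ 0#)
    ⟦⊖⟧ zero (suc n) = sym (+-identityˡ _)
    ⟦⊖⟧ (suc m) zero = sym (trans (+-congˡ -0#≈0#) (+-identityʳ _))
    ⟦⊖⟧ (suc m) (suc n) = begin
      ⟦ suc m ℤ.⊖ suc n ⟧ℤ ≡⟨ ≡.cong ⟦_⟧ℤ (ℤₚ.[1+m]⊖[1+n]≡m⊖n m n) ⟩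
      ⟦ m ℤ.⊖ n ⟧ℤ ≈⟨ ⟦⊖⟧ m n ⟩
      a - b ≈⟨ +-congʳ (+-identityˡ a) ⟨
      (0# + a) - b ≈⟨ +-congʳ (+-congʳ (-‿inverseʳ 1#)) ⟨
      (1# - 1# + a) - b ≈⟨ +-congʳ (+-assoc 1# (- 1#) a) ⟩
      (1# + (- 1# + a)) - b ≈⟨ +-congʳ (+-congˡ (+-comm (- 1#) a)) ⟩
      (1# + (a - 1#)) - b ≈⟨ +-congʳ (+-assoc 1# a (- 1#)) ⟨
      (1# + a - 1#) - b ≈⟨ +-assoc (1# + a) (- 1#) (- b) ⟩
      (1# + a) + (- 1# - b) ≈⟨ +-congˡ (⁻¹-∙-comm 1# b) ⟩
      (1# + a) - (1# + b) ≈⟨ +-cong (1+× m 1#) (-‿cong (1+× n 1#)) ⟨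
      suc m · 1# - suc n · 1# ∎
      where
      a = m · 1#
      b = n · 1#

    ⟦+⟧ : ∀ x y → ⟦ x ℤ.+ y ⟧ℤ ≈ ⟦ x ⟧ℤ + ⟦ y ⟧ℤ
    ⟦+⟧ (+ m) (+ n) = ×-homo-+ 1# m n
    ⟦+⟧ (+ m) -[1+ n ] = ⟦⊖⟧ m (suc n)
    ⟦+⟧ -[1+ m ] (+ n) = trans (⟦⊖⟧ n (suc m)) (+-comm _ _)
    ⟦+⟧ -[1+ m ] -[1+ n ] = begin
      - (suc (suc (m ℕ.+ n)) · 1#) ≡⟨ ≡.cong (λ k → - (suc k · 1#)) (ℕₚ.+-suc m n) ⟨
      - ((suc m ℕ.+ suc n) · 1#) ≈⟨ -‿cong (×-homo-+ 1# (suc m) (suc n)) ⟩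
      - (suc m · 1# + suc n · 1#) ≈⟨ ⁻¹-∙-comm _ _ ⟨
      - (suc m · 1#) - (suc n · 1#) ∎

    ⟦*⟧⁺ : ∀ m n → ⟦ + m ℤ.* + n ⟧ℤ ≈ ⟦ + m ⟧ℤ * ⟦ + n ⟧ℤ
    ⟦*⟧⁺ m n = trans (reflexive (≡.cong ⟦_⟧ℤ (≡.sym (ℤₚ.pos-* m n)))) (×1-homo-* m n)

    ⟦*⟧ˡ : ∀ m y → ⟦ + m ℤ.* y ⟧ℤ ≈ ⟦ + m ⟧ℤ * ⟦ y ⟧ℤ
    ⟦*⟧ˡ m (+ n) = ⟦*⟧⁺ m n
    ⟦*⟧ˡ m -[1+ n ] = begin
      ⟦ + m ℤ.* (ℤ.- (+ suc n)) ⟧ℤ ≡⟨ ≡.cong ⟦_⟧ℤ (ℤₚ.neg-distribʳ-* (+ m) (+ suc n)) ⟨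
      ⟦ ℤ.- (+ m ℤ.* + suc n) ⟧ℤ ≈⟨ ⟦-⟧ (+ m ℤ.* + suc n) ⟩
      - ⟦ + m ℤ.* + suc n ⟧ℤ ≈⟨ -‿cong (⟦*⟧⁺ m (suc n)) ⟩
      - (m · 1# * suc n · 1#) ≈⟨ -‿distribʳ-* _ _ ⟩
      m · 1# * - (suc n · 1#) ∎

    ⟦*⟧ : ∀ x y → ⟦ x ℤ.* y ⟧ℤ ≈ ⟦ x ⟧ℤ * ⟦ y ⟧ℤ
    ⟦*⟧ (+ m) y = ⟦*⟧ˡ m y
    ⟦*⟧ -[1+ m ] y = begin
      ⟦ (ℤ.- (+ suc m)) ℤ.* y ⟧ℤ ≡⟨ ≡.cong ⟦_⟧ℤ (ℤₚ.neg-distribˡ-* (+ suc m) y) ⟨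
      ⟦ ℤ.- (+ suc m ℤ.* y) ⟧ℤ ≈⟨ ⟦-⟧ (+ suc m ℤ.* y) ⟩
      - ⟦ + suc m ℤ.* y ⟧ℤ ≈⟨ -‿cong (⟦*⟧ˡ (suc m) y) ⟩
      - (suc m · 1# * ⟦ y ⟧ℤ) ≈⟨ -‿distribˡ-* _ _ ⟩
      - (suc m · 1#) * ⟦ y ⟧ℤ ∎

    morphism : CommutativeRing.rawRing ℤₚ.+-*-commutativeRing -Raw-AlmostCommutative⟶ fromCommutativeRing R
    morphism = record
      { ⟦_⟧ = ⟦_⟧ℤ ; +-homo = ⟦+⟧ ; *-homo = ⟦*⟧ ; -‿homo = ⟦-⟧ ; 0-homo = refl ; 1-homo = refl }

  open import Algebra.Solver.Ring (CommutativeRing.rawRing ℤₚ.+-*-commutativeRing) (fromCommutativeRing R) morphism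
    (λ x y → Maybe.map (λ e → reflexive (≡.cong ⟦_⟧ℤ e)) (dec⇒maybe (x ℤₚ.≟ y))) public
    using (solve; _:=_; _:+_; _:*_; _:-_; :-_; con; Polynomial)

  :0 :1 : ∀ {n} → Polynomial n
  :0 = con (+ 0)
  :1 = con (+ 1)

double : ℕ → ℕ
double zero = zero
double (suc n) = suc (suc (double n))

module DiagonalSums (R : CommutativeRing 0ℓ 0ℓ) where
  open CommutativeRing R renaming (zero to *-zero)
  open IntegerCoefficients R
  open import Relation.Binary.Reasoning.Setoid setoid

  -- diag f n = Σ_{i+j=n} f i j
  diag : (ℕ → ℕ → Carrier) → ℕ → Carrier
  diag f zero = f 0 0
  diag f (suc n) = f 0 (suc n) + diag (λ i j → f (suc i) j) n

  diag-cong : ∀ {f g} n → (∀ i j → i ℕ.+ j ≡ n → f i j ≈ g i j) → diag f n ≈ diag g n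
  diag-cong zero h = h 0 0 ≡.refl
  diag-cong (suc n) h = +-cong (h 0 (suc n) ≡.refl) (diag-cong n λ i j e → h (suc i) j (≡.cong suc e))

  diag-+ : ∀ f g n → diag (λ i j → f i j + g i j) n ≈ diag f n + diag g n
  diag-+ f g zero = refl
  diag-+ f g (suc n) = trans (+-congˡ (diag-+ _ _ n))
    (solve 4 (λ a b c d → (a :+ b) :+ (c :+ d) := (a :+ c) :+ (b :+ d)) refl _ _ _ _)

  *-diag : ∀ x f n → x * diag f n ≈ diag (λ i j → x * f i j) n
  *-diag x f zero = refl
  *-diag x f (suc n) = trans (distribˡ x _ _) (+-congˡ (*-diag x _ n))

  diag-* : ∀ x f n → diag f n * x ≈ diag (λ i j → f i j * x) n
  diag-* x f n = trans (*-comm _ x) (trans (*-diag x f n) (diag-cong n λ i j _ → *-comm x _))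

  diag-zero : ∀ {f} n → (∀ i j → i ℕ.+ j ≡ n → f i j ≈ 0#) → diag f n ≈ 0#
  diag-zero zero h = h 0 0 ≡.refl
  diag-zero (suc n) h = trans
    (+-cong (h 0 (suc n) ≡.refl) (diag-zero n λ i j e → h (suc i) j (≡.cong suc e))) (+-identityˡ 0#)

  diag-head : ∀ {f} n → (∀ i j → f (suc i) j ≈ 0#) → diag f n ≈ f 0 n
  diag-head zero h = refl
  diag-head (suc n) h = trans (+-congˡ (diag-zero n λ i j _ → h i j)) (+-identityʳ _)

  diag-last : ∀ f n → diag f (suc n) ≈ diag (λ i j → f i (suc j)) n + f (suc n) 0
  diag-last f zero = refl
  diag-last f (suc n) = trans (+-congˡ (diag-last (λ i → f (suc i)) n)) (sym (+-assoc _ _ _))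

  diag-swap : ∀ f n → diag f n ≈ diag (λ i j → f j i) n
  diag-swap f zero = refl
  diag-swap f (suc n) = begin
    f 0 (suc n) + diag (λ i j → f (suc i) j) n ≈⟨ +-comm _ _ ⟩
    diag (λ i j → f (suc i) j) n + f 0 (suc n) ≈⟨ +-congʳ (diag-swap _ n) ⟩
    diag (λ i j → f (suc j) i) n + f 0 (suc n) ≈⟨ diag-last (λ i j → f j i) n ⟨
    diag (λ i j → f j i) (suc n) ∎

  diag-assoc : ∀ (f : ℕ → ℕ → ℕ → Carrier) n →
    diag (λ s k → diag (λ i j → f i j k) s) n ≈ diag (λ i r → diag (f i) r) n
  diag-assoc f zero = refl
  diag-assoc f (suc n) = begin
    f 0 0 (suc n) + diag (λ s k → f 0 (suc s) k + diag (λ i j → f (suc i) j k) s) n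
      ≈⟨ +-congˡ (diag-+ _ _ n) ⟩
    f 0 0 (suc n) + (diag (λ s k → f 0 (suc s) k) n + diag (λ s k → diag (λ i j → f (suc i) j k) s) n)
      ≈⟨ +-assoc _ _ _ ⟨
    diag (f 0) (suc n) + diag (λ s k → diag (λ i j → f (suc i) j k) s) n
      ≈⟨ +-congˡ (diag-assoc (λ i → f (suc i)) n) ⟩
    diag (f 0) (suc n) + diag (λ i r → diag (f (suc i)) r) n ∎

  diag-split : ∀ {f} f₁ f₂ n → (∀ i j → i ℕ.+ j ≡ suc n → f i j ≈ f₁ i j + f₂ i j) →
    (∀ i → f₁ i 0 ≈ 0#) → (∀ j → f₂ 0 j ≈ 0#) →
    diag f (suc n) ≈ diag (λ i j → f₁ i (suc j) + f₂ (suc i) j) n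
  diag-split {f} f₁ f₂ n h h₁ h₂ = begin
    diag f (suc n) ≈⟨ diag-cong (suc n) h ⟩
    diag (λ i j → f₁ i j + f₂ i j) (suc n) ≈⟨ diag-+ f₁ f₂ (suc n) ⟩
    diag f₁ (suc n) + diag f₂ (suc n) ≈⟨ +-cong (diag-last f₁ n) (+-congʳ (h₂ (suc n))) ⟩
    (diag (λ i j → f₁ i (suc j)) n + f₁ (suc n) 0) + (0# + diag (λ i j → f₂ (suc i) j) n)
      ≈⟨ +-cong (trans (+-congˡ (h₁ (suc n))) (+-identityʳ _)) (+-identityˡ _) ⟩
    diag (λ i j → f₁ i (suc j)) n + diag (λ i j → f₂ (suc i) j) n ≈⟨ diag-+ _ _ n ⟨
    diag (λ i j → f₁ i (suc j) + f₂ (suc i) j) n ∎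

  -- The pairs with i + j = 2n are (j , j) and the two orders of (2m + j , j), with m + j = n.
  fold : (ℕ → ℕ → Carrier) → ℕ → ℕ → Carrier
  fold f zero j = f j j
  fold f (suc m) j = f (double (suc m) ℕ.+ j) j + f j (double (suc m) ℕ.+ j)

  foldOdd : (ℕ → ℕ → Carrier) → ℕ → ℕ → Carrier
  foldOdd f m j = f (suc (double m ℕ.+ j)) j + f j (suc (double m ℕ.+ j))

  private
    outer : ∀ f n → diag f (suc (suc n)) ≈ diag (λ i j → f (suc i) (suc j)) n + (f (suc (suc n)) 0 + f 0 (suc (suc n)))
    outer f n = trans (+-congˡ (diag-last (λ i j → f (suc i) j) n))
      (solve 3 (λ a b c → a :+ (b :+ c) := b :+ (c :+ a)) refl _ _ _)

  diag-double : ∀ f n → diag f (double n) ≈ diag (fold f) n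
  diag-double f zero = refl
  diag-double f (suc n) = begin
    diag f (double (suc n)) ≈⟨ outer f (double n) ⟩
    diag (λ i j → f (suc i) (suc j)) (double n) + (f (double (suc n)) 0 + f 0 (double (suc n)))
      ≈⟨ +-congʳ (diag-double (λ i j → f (suc i) (suc j)) n) ⟩
    diag (fold (λ i j → f (suc i) (suc j))) n + (f (double (suc n)) 0 + f 0 (double (suc n)))
      ≈⟨ +-cong (diag-cong n λ i j _ → step i j)
           (reflexive (≡.cong₂ (λ a b → f a 0 + f 0 b) (≡.sym (ℕₚ.+-identityʳ _)) (≡.sym (ℕₚ.+-identityʳ _)))) ⟩
    diag (λ i j → fold f i (suc j)) n + fold f (suc n) 0 ≈⟨ diag-last (fold f) n ⟨
    diag (fold f) (suc n) ∎
    where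
    step : ∀ i j → fold (λ i j → f (suc i) (suc j)) i j ≈ fold f i (suc j)
    step zero j = refl
    step (suc i) j = reflexive (≡.cong₂ (λ a b → f a (suc j) + f (suc j) b)
      (≡.sym (ℕₚ.+-suc _ j)) (≡.sym (ℕₚ.+-suc _ j)))

  diag-double+1 : ∀ f n → diag f (suc (double n)) ≈ diag (foldOdd f) n
  diag-double+1 f zero = +-comm _ _
  diag-double+1 f (suc n) = begin
    diag f (suc (double (suc n))) ≈⟨ outer f (suc (double n)) ⟩
    diag (λ i j → f (suc i) (suc j)) (suc (double n)) + (f (suc (double (suc n))) 0 + f 0 (suc (double (suc n))))
      ≈⟨ +-congʳ (diag-double+1 (λ i j → f (suc i) (suc j)) n) ⟩
    diag (foldOdd (λ i j → f (suc i) (suc j))) n + (f (suc (double (suc n))) 0 + f 0 (suc (double (suc n))))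
      ≈⟨ +-cong (diag-cong n λ i j _ → reflexive (≡.cong₂ (λ a b → f a (suc j) + f (suc j) b)
             (≡.cong suc (≡.sym (ℕₚ.+-suc _ j))) (≡.cong suc (≡.sym (ℕₚ.+-suc _ j)))))
           (reflexive (≡.cong₂ (λ a b → f (suc a) 0 + f 0 (suc b)) (≡.sym (ℕₚ.+-identityʳ _)) (≡.sym (ℕₚ.+-identityʳ _)))) ⟩
    diag (λ i j → foldOdd f i (suc j)) n + foldOdd f (suc n) 0 ≈⟨ diag-last (foldOdd f) n ⟨
    diag (foldOdd f) (suc n) ∎

tri : ℕ → ℕ
tri zero = 0
tri (suc n) = n ℕ.+ tri n

double≡+ : ∀ n → double n ≡ n ℕ.+ n
double≡+ zero = ≡.refl
double≡+ (suc n) = ≡.cong suc (≡.trans (≡.cong suc (double≡+ n)) (≡.sym (ℕₚ.+-suc n n)))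

module QSeries (R : CommutativeRing 0ℓ 0ℓ) where
  open CommutativeRing R renaming (zero to *-zero)
  open IntegerCoefficients R
  open DiagonalSums R
  open import Algebra.Properties.Semiring.Exp semiring
  open import Relation.Binary.Reasoning.Setoid setoid

  infixl 7.5 _⨾_⟨_⟩

  _⨾_⟨_⟩ : Carrier → Carrier → ℕ → Carrier
  x ⨾ q ⟨ zero ⟩ = 1#
  x ⨾ q ⟨ suc n ⟩ = x ⨾ q ⟨ n ⟩ * (1# - x * q ^ n)

  -- u n = 1/(q;q)ₙ
  record Reciprocal (q : Carrier) (u : ℕ → Carrier) : Set where
    field
      u0 : u 0 ≈ 1#
      step : ∀ n → (1# - q ^ suc n) * u (suc n) ≈ u n

  ε : Carrier
  ε = - 1#

  ε²≈1 : ∀ n → ε ^ n * ε ^ n ≈ 1#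
  ε²≈1 zero = *-identityˡ 1#
  ε²≈1 (suc n) = trans (solve 1 (λ x → (:- :1 :* x) :* (:- :1 :* x) := x :* x) refl (ε ^ n)) (ε²≈1 n)

  ε^double : ∀ n → ε ^ double n ≈ 1#
  ε^double n = trans (^-congʳ ε (double≡+ n)) (trans (^-homo-* ε n n) (ε²≈1 n))

  ^-merge : ∀ x a b {c} → a ℕ.+ b ≡ c → x ^ a * x ^ b ≈ x ^ c
  ^-merge x a b e = trans (sym (^-homo-* x a b)) (^-congʳ x e)

  ^-split : ∀ x a b {c} → a ℕ.+ b ≡ c → x ^ c ≈ x ^ a * x ^ b
  ^-split x a b e = sym (^-merge x a b e)

  cancel-unit : ∀ {d k x y} → d * k ≈ 1# → d * x ≈ d * y → x ≈ y
  cancel-unit {d} {k} {x} {y} dk≈1 dx≈dy = begin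
    x ≈⟨ *-identityˡ x ⟨
    1# * x ≈⟨ *-congʳ dk≈1 ⟨
    d * k * x ≈⟨ solve 3 (λ d k x → d :* k :* x := k :* (d :* x)) refl d k x ⟩
    k * (d * x) ≈⟨ *-congˡ dx≈dy ⟩
    k * (d * y) ≈⟨ solve 3 (λ d k x → d :* k :* x := k :* (d :* x)) refl d k y ⟨
    d * k * y ≈⟨ *-congʳ dk≈1 ⟩
    1# * y ≈⟨ *-identityˡ y ⟩
    y ∎

  [1-1]* : ∀ x → (1# - 1#) * x ≈ 0#
  [1-1]* x = solve 1 (λ x → (:1 :- :1) :* x := :0) refl x

  module _ {q : Carrier} {u : ℕ → Carrier} (rec : Reciprocal q u) where
    open Reciprocal rec

    private
      [q^0] : ∀ x → (1# - q ^ 0) * x ≈ 0#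
      [q^0] = [1-1]*

    reciprocal : ∀ n → q ⨾ q ⟨ n ⟩ * u n ≈ 1#
    reciprocal zero = trans (*-identityˡ _) u0
    reciprocal (suc n) = trans (*-assoc _ _ _) (trans (*-congˡ (step n)) (reciprocal n))

    cancel : ∀ n {x y} → (1# - q ^ suc n) * x ≈ (1# - q ^ suc n) * y → x ≈ y
    cancel n = cancel-unit (begin
      (1# - q ^ suc n) * (q ⨾ q ⟨ n ⟩ * u (suc n)) ≈⟨ solve 3 (λ a b c → a :* (b :* c) := b :* (a :* c)) refl _ _ _ ⟩
      q ⨾ q ⟨ n ⟩ * ((1# - q ^ suc n) * u (suc n)) ≈⟨ *-congˡ (step n) ⟩
      q ⨾ q ⟨ n ⟩ * u n ≈⟨ reciprocal n ⟩
      1# ∎)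

    unique : ∀ {w : ℕ → Carrier} → w 0 ≈ 1# → (∀ n → (1# - q ^ suc n) * w (suc n) ≈ w n) → ∀ n → w n ≈ u n
    unique w0 h zero = trans w0 (sym u0)
    unique {w} w0 h (suc n) = cancel n (trans (h n) (trans (unique {w} w0 h n) (sym (step n))))

    vandermonde : ∀ n c → diag (λ j k → q ^ (j ℕ.* (j ℕ.+ c)) * u j * u (c ℕ.+ j) * u k) n ≈ u n * u (c ℕ.+ n)
    vandermonde zero c = trans (*-congˡ u0) (solve 2 (λ a b → :1 :* a :* b :* :1 := a :* b) refl _ _)
    vandermonde (suc n) c = cancel n (begin
      (1# - q ^ suc n) * diag g (suc n) ≈⟨ *-diag _ g (suc n) ⟩
      diag (λ i j → (1# - q ^ suc n) * g i j) (suc n) ≈⟨ diag-split f₁ f₂ n split f₁0 f₂0 ⟩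
      diag (λ i j → f₁ i (suc j) + f₂ (suc i) j) n ≈⟨ diag-cong n combine ⟩
      diag (λ i j → q ^ (i ℕ.* (i ℕ.+ c)) * u i * u (c ℕ.+ i) * u j
        + q ^ suc (c ℕ.+ n) * (q ^ (i ℕ.* (i ℕ.+ suc c)) * u i * u (suc c ℕ.+ i) * u j)) n
        ≈⟨ trans (diag-+ _ _ n) (+-cong (vandermonde n c) (trans (sym (*-diag _ _ n)) (*-congˡ (vandermonde n (suc c))))) ⟩
      u n * u (c ℕ.+ n) + q ^ suc (c ℕ.+ n) * (u n * u (suc (c ℕ.+ n)))
        ≈⟨ +-congʳ (*-congˡ (step (c ℕ.+ n))) ⟨
      u n * ((1# - q ^ suc (c ℕ.+ n)) * u (suc (c ℕ.+ n))) + q ^ suc (c ℕ.+ n) * (u n * u (suc (c ℕ.+ n)))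
        ≈⟨ solve 3 (λ a b x → a :* ((:1 :- x) :* b) :+ x :* (a :* b) := a :* b) refl _ _ _ ⟩
      u n * u (suc (c ℕ.+ n)) ≈⟨ *-cong (step n) (reflexive (≡.cong u (ℕₚ.+-suc c n))) ⟨
      (1# - q ^ suc n) * u (suc n) * u (c ℕ.+ suc n) ≈⟨ *-assoc _ _ _ ⟩
      (1# - q ^ suc n) * (u (suc n) * u (c ℕ.+ suc n)) ∎)
      where
      g f₁ f₂ : ℕ → ℕ → Carrier
      g j k = q ^ (j ℕ.* (j ℕ.+ c)) * u j * u (c ℕ.+ j) * u k
      f₁ i j = q ^ (i ℕ.* (i ℕ.+ c)) * u i * u (c ℕ.+ i) * ((1# - q ^ j) * u j)
      f₂ i j = q ^ j * q ^ (i ℕ.* (i ℕ.+ c)) * u (c ℕ.+ i) * u j * ((1# - q ^ i) * u i)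
      split : ∀ i j → i ℕ.+ j ≡ suc n → (1# - q ^ suc n) * g i j ≈ f₁ i j + f₂ i j
      split i j e = trans (*-congʳ (+-congˡ (-‿cong (^-split q i j e))))
        (solve 6 (λ a b x ui uc uj → (:1 :- a :* b) :* (x :* ui :* uc :* uj)
          := x :* ui :* uc :* ((:1 :- b) :* uj) :+ b :* x :* uc :* uj :* ((:1 :- a) :* ui)) refl _ _ _ _ _ _)
      f₁0 : ∀ i → f₁ i 0 ≈ 0#
      f₁0 i = trans (*-congˡ ([q^0] _)) (zeroʳ _)
      f₂0 : ∀ j → f₂ 0 j ≈ 0#
      f₂0 j = trans (*-congˡ ([q^0] _)) (zeroʳ _)
      expo : ∀ i j c → j ℕ.+ suc i ℕ.* (suc i ℕ.+ c) ≡ suc (c ℕ.+ (i ℕ.+ j)) ℕ.+ i ℕ.* (i ℕ.+ suc c)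
      expo = solve-∀
      expo′ : ∀ i j → i ℕ.+ j ≡ n → q ^ j * q ^ (suc i ℕ.* (suc i ℕ.+ c)) ≈ q ^ suc (c ℕ.+ n) * q ^ (i ℕ.* (i ℕ.+ suc c))
      expo′ i j e = trans (^-merge q j (suc i ℕ.* (suc i ℕ.+ c)) (≡.trans (expo i j c) (≡.cong (λ n → suc (c ℕ.+ n) ℕ.+ i ℕ.* (i ℕ.+ suc c)) e)))
        (^-homo-* q (suc (c ℕ.+ n)) _)
      combine : ∀ i j → i ℕ.+ j ≡ n → f₁ i (suc j) + f₂ (suc i) j ≈ q ^ (i ℕ.* (i ℕ.+ c)) * u i * u (c ℕ.+ i) * u j
        + q ^ suc (c ℕ.+ n) * (q ^ (i ℕ.* (i ℕ.+ suc c)) * u i * u (suc c ℕ.+ i) * u j)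
      combine i j e = +-cong (*-congˡ (step j)) (trans
        (*-cong (*-congʳ (*-cong (expo′ i j e) (reflexive (≡.cong u (ℕₚ.+-suc c i))))) (step i))
        (solve 5 (λ a b uc uj ui → a :* b :* uc :* uj :* ui := a :* (b :* ui :* uc :* uj)) refl _ _ _ _ _))

    -- Bailey's lemma (with both parameters sent to infinity), relative to a = q^e.
    bailey : ∀ e (α : ℕ → Carrier) n →
      diag (λ s k → q ^ (s ℕ.* (s ℕ.+ e)) * diag (λ m j → α m * u j * u (e ℕ.+ double m ℕ.+ j)) s * u k) n
      ≈ diag (λ m j → q ^ (m ℕ.* (m ℕ.+ e)) * α m * u j * u (e ℕ.+ double m ℕ.+ j)) n
    bailey e α n = begin
      diag (λ s k → q ^ (s ℕ.* (s ℕ.+ e)) * diag (λ m j → α m * u j * u (e ℕ.+ double m ℕ.+ j)) s * u k) n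
        ≈⟨ diag-cong n (λ s k _ → inside s k) ⟩
      diag (λ s k → diag (λ m j → f m j k) s) n ≈⟨ diag-assoc f n ⟩
      diag (λ m r → diag (f m) r) n ≈⟨ diag-cong n (λ m r _ → sum m r) ⟩
      diag (λ m j → q ^ (m ℕ.* (m ℕ.+ e)) * α m * u j * u (e ℕ.+ double m ℕ.+ j)) n ∎
      where
      f : ℕ → ℕ → ℕ → Carrier
      f m j k = q ^ ((m ℕ.+ j) ℕ.* ((m ℕ.+ j) ℕ.+ e)) * (α m * u j * u (e ℕ.+ double m ℕ.+ j)) * u k
      inside : ∀ s k → q ^ (s ℕ.* (s ℕ.+ e)) * diag (λ m j → α m * u j * u (e ℕ.+ double m ℕ.+ j)) s * u k
        ≈ diag (λ m j → f m j k) s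
      inside s k = trans (*-congʳ (*-diag _ _ s)) (trans (diag-* _ _ s)
        (diag-cong s λ m j e′ → *-congʳ (*-congʳ (^-congʳ q (≡.cong (λ s → s ℕ.* (s ℕ.+ e)) (≡.sym e′))))))
      expo : ∀ m j e → m ℕ.* (m ℕ.+ e) ℕ.+ j ℕ.* (j ℕ.+ (e ℕ.+ (m ℕ.+ m))) ≡ (m ℕ.+ j) ℕ.* ((m ℕ.+ j) ℕ.+ e)
      expo = solve-∀
      sum : ∀ m r → diag (f m) r ≈ q ^ (m ℕ.* (m ℕ.+ e)) * α m * u r * u (e ℕ.+ double m ℕ.+ r)
      sum m r = begin
        diag (f m) r ≈⟨ diag-cong r (λ j k _ → trans (*-congʳ (*-congʳ (^-split q (m ℕ.* (m ℕ.+ e)) (j ℕ.* (j ℕ.+ (e ℕ.+ double m)))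
          (≡.trans (≡.cong (λ d → m ℕ.* (m ℕ.+ e) ℕ.+ j ℕ.* (j ℕ.+ (e ℕ.+ d))) (double≡+ m)) (expo m j e)))))
          (solve 6 (λ a b x uj uc uk → a :* b :* (x :* uj :* uc) :* uk := a :* x :* (b :* uj :* uc :* uk)) refl _ _ _ _ _ _)) ⟩
        diag (λ j k → q ^ (m ℕ.* (m ℕ.+ e)) * α m * (q ^ (j ℕ.* (j ℕ.+ (e ℕ.+ double m))) * u j * u (e ℕ.+ double m ℕ.+ j) * u k)) r
          ≈⟨ *-diag _ _ r ⟨
        q ^ (m ℕ.* (m ℕ.+ e)) * α m * diag (λ j k → q ^ (j ℕ.* (j ℕ.+ (e ℕ.+ double m))) * u j * u (e ℕ.+ double m ℕ.+ j) * u k) r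
          ≈⟨ *-congˡ (vandermonde r (e ℕ.+ double m)) ⟩
        q ^ (m ℕ.* (m ℕ.+ e)) * α m * (u r * u (e ℕ.+ double m ℕ.+ r)) ≈⟨ *-assoc _ _ _ ⟨
        q ^ (m ℕ.* (m ℕ.+ e)) * α m * u r * u (e ℕ.+ double m ℕ.+ r) ∎

module Units (R : CommutativeRing 0ℓ 0ℓ) where
  open CommutativeRing R renaming (zero to *-zero)
  open IntegerCoefficients R
  open DiagonalSums R
  open QSeries R
  open import Algebra.Properties.Semiring.Exp semiring
  open import Relation.Binary.Reasoning.Setoid setoid

  -- The α-sequences of the unit Bailey pairs relative to a = 1 and a = q, with
  -- the indices m and −m (respectively m and −m−1) merged.
  unit₀ unit₁ : Carrier → ℕ → Carrier
  unit₀ q zero = 1#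
  unit₀ q (suc m) = ε ^ suc m * q ^ tri (suc m) * (1# + q ^ suc m)
  unit₁ q m = ε ^ m * q ^ tri m * (1# - q ^ suc (double m))

  module _ {q : Carrier} {u : ℕ → Carrier} (rec : Reciprocal q u) where
    open Reciprocal rec

    private
      q^[2m+j] : ∀ m j → q ^ (double m ℕ.+ j) ≈ q ^ m * q ^ m * q ^ j
      q^[2m+j] m j = trans (^-homo-* q (double m) j) (*-congʳ (^-split q m m (≡.sym (double≡+ m))))

    unit₀-pair : ∀ n → diag (λ m j → unit₀ q m * u j * u (double m ℕ.+ j)) (suc n) ≈ 0#
    unit₀-pair n = cancel rec n (begin
      (1# - q ^ suc n) * diag g (suc n) ≈⟨ *-diag _ g (suc n) ⟩
      diag (λ i j → (1# - q ^ suc n) * g i j) (suc n) ≈⟨ diag-split f₁ f₂ n split f₁0 (λ _ → refl) ⟩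
      diag (λ i j → f₁ i (suc j) + f₂ (suc i) j) n ≈⟨ diag-zero n (λ i j _ → telescope i j) ⟩
      0# ≈⟨ zeroʳ _ ⟨
      (1# - q ^ suc n) * 0# ∎)
      where
      g f₁ f₂ : ℕ → ℕ → Carrier
      g m j = unit₀ q m * u j * u (double m ℕ.+ j)
      f₁ m j = ε ^ m * q ^ (m ℕ.+ tri m) * ((1# - q ^ j) * u j) * u (double m ℕ.+ j)
      f₂ zero j = 0#
      f₂ (suc m) j = ε ^ suc m * q ^ tri (suc m) * u j * ((1# - q ^ (double (suc m) ℕ.+ j)) * u (double (suc m) ℕ.+ j))
      split : ∀ i j → i ℕ.+ j ≡ suc n → (1# - q ^ suc n) * g i j ≈ f₁ i j + f₂ i j
      split zero j ≡.refl = solve 2 (λ a uj → (:1 :- a) :* (:1 :* uj :* uj)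
        := :1 :* :1 :* ((:1 :- a) :* uj) :* uj :+ :0) refl _ _
      split i@(suc m) j e = begin
        (1# - q ^ suc n) * g i j ≈⟨ *-congʳ (+-congˡ (-‿cong (^-split q i j e))) ⟩
        (1# - q ^ i * q ^ j) * g i j
          ≈⟨ solve 6 (λ s x a b uj uk → (:1 :- a :* b) :* (s :* x :* (:1 :+ a) :* uj :* uk)
            := s :* (a :* x) :* ((:1 :- b) :* uj) :* uk :+ s :* x :* uj :* ((:1 :- a :* a :* b) :* uk)) refl _ _ _ _ _ _ ⟩
        ε ^ i * (q ^ i * q ^ tri i) * ((1# - q ^ j) * u j) * u (double i ℕ.+ j)
          + ε ^ i * q ^ tri i * u j * ((1# - q ^ i * q ^ i * q ^ j) * u (double i ℕ.+ j))
          ≈⟨ +-cong (*-congʳ (*-congʳ (*-congˡ (^-homo-* q i (tri i)))))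
                    (*-congˡ (*-congʳ (+-congˡ (-‿cong (q^[2m+j] i j))))) ⟨
        f₁ i j + f₂ i j ∎
      f₁0 : ∀ i → f₁ i 0 ≈ 0#
      f₁0 i = trans (*-congʳ (trans (*-congˡ ([1-1]* _)) (zeroʳ _))) (zeroˡ _)
      telescope : ∀ i j → f₁ i (suc j) + f₂ (suc i) j ≈ 0#
      telescope i j = trans
        (+-cong (*-cong (*-congˡ (step j)) (reflexive (≡.cong u (ℕₚ.+-suc (double i) j)))) (*-congˡ (step (suc (double i ℕ.+ j)))))
        (solve 4 (λ s x uj uk → s :* x :* uj :* uk :+ :- :1 :* s :* x :* uj :* uk := :0) refl _ _ _ _)

    unit₁-pair : ∀ n → diag (λ m j → unit₁ q m * u j * u (suc (double m ℕ.+ j))) (suc n) ≈ 0#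
    unit₁-pair n = cancel rec n (begin
      (1# - q ^ suc n) * diag g (suc n) ≈⟨ *-diag _ g (suc n) ⟩
      diag (λ i j → (1# - q ^ suc n) * g i j) (suc n) ≈⟨ diag-split f₁ f₂ n split f₁0 f₂0 ⟩
      diag (λ i j → f₁ i (suc j) + f₂ (suc i) j) n ≈⟨ diag-zero n (λ i j _ → telescope i j) ⟩
      0# ≈⟨ zeroʳ _ ⟨
      (1# - q ^ suc n) * 0# ∎)
      where
      g f₁ f₂ : ℕ → ℕ → Carrier
      g m j = unit₁ q m * u j * u (suc (double m ℕ.+ j))
      f₁ m j = ε ^ m * q ^ (m ℕ.+ tri m) * (1# - q ^ suc m) * ((1# - q ^ j) * u j) * u (suc (double m ℕ.+ j))
      f₂ m j = ε ^ m * q ^ tri m * u j * ((1# - q ^ suc (double m ℕ.+ j)) * u (suc (double m ℕ.+ j))) * (1# - q ^ m)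
      split : ∀ i j → i ℕ.+ j ≡ suc n → (1# - q ^ suc n) * g i j ≈ f₁ i j + f₂ i j
      split i j e = begin
        (1# - q ^ suc n) * g i j ≈⟨ *-cong (+-congˡ (-‿cong (^-split q i j e)))
           (*-congʳ (*-congʳ (*-congˡ (+-congˡ (-‿cong (*-congˡ (^-split q i i (≡.sym (double≡+ i))))))))) ⟩
        (1# - q ^ i * q ^ j) * (ε ^ i * q ^ tri i * (1# - q * (q ^ i * q ^ i)) * u j * u (suc (double i ℕ.+ j)))
          ≈⟨ solve 7 (λ s x a b uj uk q → (:1 :- a :* b) :* (s :* x :* (:1 :- q :* (a :* a)) :* uj :* uk)
            := s :* (a :* x) :* (:1 :- q :* a) :* ((:1 :- b) :* uj) :* uk
               :+ s :* x :* uj :* ((:1 :- q :* (a :* a :* b)) :* uk) :* (:1 :- a)) refl _ _ _ _ _ _ _ ⟩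
        ε ^ i * (q ^ i * q ^ tri i) * (1# - q * q ^ i) * ((1# - q ^ j) * u j) * u (suc (double i ℕ.+ j))
          + ε ^ i * q ^ tri i * u j * ((1# - q * (q ^ i * q ^ i * q ^ j)) * u (suc (double i ℕ.+ j))) * (1# - q ^ i)
          ≈⟨ +-cong (*-congʳ (*-congʳ (*-congʳ (*-congˡ (^-homo-* q i (tri i))))))
                    (*-congʳ (*-congˡ (*-congʳ (+-congˡ (-‿cong (*-congˡ (q^[2m+j] i j))))))) ⟨
        f₁ i j + f₂ i j ∎
      f₁0 : ∀ i → f₁ i 0 ≈ 0#
      f₁0 i = trans (*-congʳ (trans (*-congˡ ([1-1]* _)) (zeroʳ _))) (zeroˡ _)
      f₂0 : ∀ j → f₂ 0 j ≈ 0#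
      f₂0 j = trans (*-comm _ _) ([1-1]* _)
      telescope : ∀ i j → f₁ i (suc j) + f₂ (suc i) j ≈ 0#
      telescope i j = trans
        (+-cong (*-cong (*-congˡ (step j)) (reflexive (≡.cong (λ k → u (suc k)) (ℕₚ.+-suc (double i) j))))
                (*-congʳ (*-congˡ (step (suc (suc (double i ℕ.+ j)))))))
        (solve 5 (λ s x uj uk y → s :* x :* y :* uj :* uk :+ :- :1 :* s :* x :* uj :* uk :* y := :0) refl _ _ _ _ _)

    -- Two applications of Bailey's lemma to a unit pair.
    finite-RR : ∀ e (α : ℕ → Carrier) → α 0 * u e ≈ 1# →
      (∀ n → diag (λ m j → α m * u j * u (e ℕ.+ double m ℕ.+ j)) (suc n) ≈ 0#) → ∀ n →
      diag (λ s k → q ^ (s ℕ.* (s ℕ.+ e)) * u s * u k) n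
      ≈ diag (λ m j → q ^ (m ℕ.* (m ℕ.+ e)) * (q ^ (m ℕ.* (m ℕ.+ e)) * α m) * u j * u (e ℕ.+ double m ℕ.+ j)) n
    finite-RR e α α0 αsuc n = begin
      diag (λ s k → q ^ (s ℕ.* (s ℕ.+ e)) * u s * u k) n
        ≈⟨ diag-cong n (λ s k _ → *-congʳ (*-congˡ (sym (once s)))) ⟩
      diag (λ s k → q ^ (s ℕ.* (s ℕ.+ e)) * diag (λ m j → q ^ (m ℕ.* (m ℕ.+ e)) * α m * u j * u (e ℕ.+ double m ℕ.+ j)) s * u k) n
        ≈⟨ bailey rec e (λ m → q ^ (m ℕ.* (m ℕ.+ e)) * α m) n ⟩
      diag (λ m j → q ^ (m ℕ.* (m ℕ.+ e)) * (q ^ (m ℕ.* (m ℕ.+ e)) * α m) * u j * u (e ℕ.+ double m ℕ.+ j)) n ∎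
      where
      β : ℕ → Carrier
      β s = diag (λ m j → α m * u j * u (e ℕ.+ double m ℕ.+ j)) s
      β0 : β 0 ≈ 1#
      β0 = trans (*-cong (*-congˡ u0) (reflexive (≡.cong u (≡.trans (ℕₚ.+-identityʳ _) (ℕₚ.+-identityʳ e)))))
        (trans (*-congʳ (*-identityʳ _)) α0)
      once : ∀ n → diag (λ m j → q ^ (m ℕ.* (m ℕ.+ e)) * α m * u j * u (e ℕ.+ double m ℕ.+ j)) n ≈ u n
      once n = begin
        diag (λ m j → q ^ (m ℕ.* (m ℕ.+ e)) * α m * u j * u (e ℕ.+ double m ℕ.+ j)) n ≈⟨ bailey rec e α n ⟨
        diag (λ s k → q ^ (s ℕ.* (s ℕ.+ e)) * β s * u k) n
          ≈⟨ diag-head n (λ s k → trans (*-congʳ (trans (*-congˡ (αsuc s)) (zeroʳ _))) (zeroˡ _)) ⟩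
        1# * β 0 * u n ≈⟨ *-congʳ (*-congˡ β0) ⟩
        1# * 1# * u n ≈⟨ trans (*-congʳ (*-identityˡ 1#)) (*-identityˡ _) ⟩
        u n ∎

module Gauss (R : CommutativeRing 0ℓ 0ℓ) where
  open CommutativeRing R renaming (zero to *-zero)
  open IntegerCoefficients R
  open DiagonalSums R
  open QSeries R
  open import Algebra.Properties.Semiring.Exp semiring
  open import Relation.Binary.Reasoning.Setoid setoid

  ^-distrib : ∀ x y n → (x * y) ^ n ≈ x ^ n * y ^ n
  ^-distrib x y zero = sym (*-identityˡ 1#)
  ^-distrib x y (suc n) = trans (*-congˡ (^-distrib x y n))
    (solve 4 (λ x y a b → x :* y :* (a :* b) := x :* a :* (y :* b)) refl _ _ _ _)

  fold-sign : ℕ → Carrier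
  fold-sign zero = 1#
  fold-sign (suc m) = ε ^ suc m + ε ^ suc m

  module _ {q : Carrier} {u : ℕ → Carrier} (rec : Reciprocal q u) where
    open Reciprocal rec

    private
      alt : ℕ → Carrier
      alt = diag (λ i j → ε ^ i * u i * u j)

      alt-step : ∀ n → (1# - q ^ suc n) * alt (suc n) ≈ diag (λ i j → ε * (ε ^ i * ((1# - q ^ i) * u i) * u j)) n
      alt-step n = begin
        (1# - q ^ suc n) * alt (suc n) ≈⟨ *-diag _ (λ i j → ε ^ i * u i * u j) (suc n) ⟩
        diag (λ i j → (1# - q ^ suc n) * (ε ^ i * u i * u j)) (suc n) ≈⟨ diag-split f₁ f₂ n split
            (λ i → trans (*-congˡ ([1-1]* _)) (zeroʳ _))
            (λ j → trans (*-congʳ (trans (*-congˡ ([1-1]* _)) (zeroʳ _))) (zeroˡ _)) ⟩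
        diag (λ i j → f₁ i (suc j) + f₂ (suc i) j) n ≈⟨ diag-cong n (λ i j _ → trans
            (+-cong (*-congˡ (step j)) (*-congʳ (*-congˡ (step i))))
            (solve 4 (λ a s ui uj → a :* s :* ui :* uj :+ :- :1 :* s :* ui :* uj := :- :1 :* (s :* ((:1 :- a) :* ui) :* uj)) refl _ _ _ _)) ⟩
        diag (λ i j → ε * (ε ^ i * ((1# - q ^ i) * u i) * u j)) n ∎
        where
        f₁ f₂ : ℕ → ℕ → Carrier
        f₁ i j = q ^ i * ε ^ i * u i * ((1# - q ^ j) * u j)
        f₂ i j = ε ^ i * ((1# - q ^ i) * u i) * u j
        split : ∀ i j → i ℕ.+ j ≡ suc n → (1# - q ^ suc n) * (ε ^ i * u i * u j) ≈ f₁ i j + f₂ i j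
        split i j e = trans (*-congʳ (+-congˡ (-‿cong (^-split q i j e))))
          (solve 5 (λ a b s ui uj → (:1 :- a :* b) :* (s :* ui :* uj) := a :* s :* ui :* ((:1 :- b) :* uj) :+ s :* ((:1 :- a) :* ui) :* uj) refl _ _ _ _ _)

      alt-0 : ∀ j → ε * (ε ^ 0 * ((1# - q ^ 0) * u 0) * u j) ≈ 0#
      alt-0 j = trans (*-congˡ (trans (*-congʳ (trans (*-congˡ ([1-1]* _)) (zeroʳ _))) (zeroˡ _))) (zeroʳ _)

      alt-step₂ : ∀ n → (1# - q ^ suc (suc n)) * alt (suc (suc n)) ≈ alt n
      alt-step₂ n = begin
        (1# - q ^ suc (suc n)) * alt (suc (suc n)) ≈⟨ alt-step (suc n) ⟩
        ε * (ε ^ 0 * ((1# - q ^ 0) * u 0) * u (suc n)) + diag (λ i j → ε * (ε ^ suc i * ((1# - q ^ suc i) * u (suc i)) * u j)) n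
          ≈⟨ +-cong (alt-0 (suc n)) (diag-cong n λ i j _ → trans (*-congˡ (*-congʳ (*-congˡ (step i))))
               (solve 3 (λ s ui uj → :- :1 :* (:- :1 :* s :* ui :* uj) := s :* ui :* uj) refl _ _ _)) ⟩
        0# + alt n ≈⟨ +-identityˡ _ ⟩
        alt n ∎

    gauss-odd : ∀ n → diag (λ i j → ε ^ i * u i * u j) (suc (double n)) ≈ 0#
    gauss-odd zero = cancel rec 0 (trans (alt-step 0) (trans (alt-0 0) (sym (zeroʳ _))))
    gauss-odd (suc n) = cancel rec (suc (suc (double n))) (trans (alt-step₂ (suc (double n))) (trans (gauss-odd n) (sym (zeroʳ _))))

    module _ {v : ℕ → Carrier} (rec² : Reciprocal (q * q) v) where
      private module V = Reciprocal rec²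

      gauss-even : ∀ n → diag (λ i j → ε ^ i * u i * u j) (double n) ≈ v n
      gauss-even = unique rec² (trans (*-cong (*-congˡ u0) u0) (trans (*-congʳ (*-identityˡ _)) (*-identityˡ _)))
        λ n → trans (*-congʳ (+-congˡ (-‿cong (trans (^-distrib q q (suc n)) (^-merge q (suc n) (suc n) (≡.sym (double≡+ (suc n))))))))
          (alt-step₂ (double n))

      gauss-q : ∀ n → diag (λ i j → q ^ i * v i * v j) n ≈ u n
      gauss-q = unique rec (trans (*-cong (*-congˡ V.u0) V.u0) (trans (*-congʳ (*-identityˡ _)) (*-identityˡ _))) λ n → begin
        (1# - q ^ suc n) * g (suc n) ≈⟨ solve 2 (λ a b → (:1 :- a) :* b := b :- a :* b) refl _ _ ⟩
        g (suc n) - q ^ suc n * g (suc n) ≈⟨ +-congʳ (trans (diag-swap (λ i j → q ^ i * v i * v j) (suc n)) (diag-cong (suc n) (split n))) ⟩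
        diag (λ i j → q ^ j * v j * ((1# - (q * q) ^ i) * v i) + q ^ suc n * (q ^ i * v i * v j)) (suc n) - q ^ suc n * g (suc n)
          ≈⟨ +-congʳ (trans (diag-+ (λ i j → q ^ j * v j * ((1# - (q * q) ^ i) * v i)) (λ i j → q ^ suc n * (q ^ i * v i * v j)) (suc n))
               (+-congˡ (sym (*-diag _ (λ i j → q ^ i * v i * v j) (suc n))))) ⟩
        diag (λ i j → q ^ j * v j * ((1# - (q * q) ^ i) * v i)) (suc n) + q ^ suc n * g (suc n) - q ^ suc n * g (suc n)
          ≈⟨ solve 2 (λ a b → a :+ b :- b := a) refl _ _ ⟩
        q ^ suc n * v (suc n) * ((1# - (q * q) ^ 0) * v 0) + diag (λ i j → q ^ j * v j * ((1# - (q * q) ^ suc i) * v (suc i))) n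
          ≈⟨ +-cong (trans (*-congˡ ([1-1]* _)) (zeroʳ _)) (diag-cong n λ i j _ → *-congˡ (V.step i)) ⟩
        0# + diag (λ i j → q ^ j * v j * v i) n ≈⟨ +-identityˡ _ ⟩
        diag (λ i j → q ^ j * v j * v i) n ≈⟨ diag-swap _ n ⟩
        g n ∎
        where
        g : ℕ → Carrier
        g = diag (λ i j → q ^ i * v i * v j)
        split : ∀ n i j → i ℕ.+ j ≡ suc n → q ^ j * v j * v i
          ≈ q ^ j * v j * ((1# - (q * q) ^ i) * v i) + q ^ suc n * (q ^ i * v i * v j)
        split n i j e = trans (solve 4 (λ a b vi vj → b :* vj :* vi := b :* vj :* ((:1 :- a :* a) :* vi) :+ a :* b :* (a :* vi :* vj)) refl (q ^ i) (q ^ j) (v i) (v j))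
          (+-cong (*-congˡ (*-congʳ (+-congˡ (-‿cong (sym (^-distrib q q i)))))) (*-congʳ (^-merge q i j e)))

      -- (zq;q²)_∞ · 1/(zq;q²)_∞ = 1
      euler-inverse : ∀ n → diag (λ i j → ε ^ i * q ^ (i ℕ.* i) * v i * (q ^ j * v j)) (suc n) ≈ 0#
      euler-inverse n = cancel rec² n (trans (f-step n) (trans (vanish n) (sym (zeroʳ _))))
        where
        f : ℕ → Carrier
        f = diag (λ i j → ε ^ i * q ^ (i ℕ.* i) * v i * (q ^ j * v j))
        f-step : ∀ n → (1# - (q * q) ^ suc n) * f (suc n) ≈ q * (1# - (q * q) ^ n) * f n
        f-step n = begin
          (1# - (q * q) ^ suc n) * f (suc n) ≈⟨ *-diag _ (λ i j → ε ^ i * q ^ (i ℕ.* i) * v i * (q ^ j * v j)) (suc n) ⟩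
          diag (λ i j → (1# - (q * q) ^ suc n) * (ε ^ i * q ^ (i ℕ.* i) * v i * (q ^ j * v j))) (suc n)
            ≈⟨ diag-split f₁ f₂ n split (λ i → trans (*-congˡ ([1-1]* _)) (zeroʳ _)) (λ j → trans (*-congˡ ([1-1]* _)) (zeroʳ _)) ⟩
          diag (λ i j → f₁ i (suc j) + f₂ (suc i) j) n ≈⟨ diag-cong n combine ⟩
          diag (λ i j → q * (1# - (q * q) ^ n) * (ε ^ i * q ^ (i ℕ.* i) * v i * (q ^ j * v j))) n ≈⟨ *-diag _ _ n ⟨
          q * (1# - (q * q) ^ n) * f n ∎
          where
          f₁ f₂ : ℕ → ℕ → Carrier
          f₁ i j = ε ^ i * q ^ (i ℕ.* i) * v i * q ^ j * ((1# - (q * q) ^ j) * v j)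
          f₂ i j = ε ^ i * q ^ (i ℕ.* i) * (q * q) ^ j * q ^ j * v j * ((1# - (q * q) ^ i) * v i)
          split : ∀ i j → i ℕ.+ j ≡ suc n → (1# - (q * q) ^ suc n) * (ε ^ i * q ^ (i ℕ.* i) * v i * (q ^ j * v j)) ≈ f₁ i j + f₂ i j
          split i j e = trans (*-congʳ (+-congˡ (-‿cong (^-split (q * q) i j e))))
            (solve 7 (λ a b s x y vi vj → (:1 :- a :* b) :* (s :* x :* vi :* (y :* vj))
              := s :* x :* vi :* y :* ((:1 :- b) :* vj) :+ s :* x :* b :* y :* vj :* ((:1 :- a) :* vi)) refl _ _ _ _ _ _ _)
          expo : ∀ i → suc (i ℕ.* i ℕ.+ (i ℕ.+ i)) ≡ suc i ℕ.* suc i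
          expo = solve-∀
          q^[1+i]² : ∀ i → q ^ (suc i ℕ.* suc i) ≈ q * (q ^ (i ℕ.* i) * (q * q) ^ i)
          q^[1+i]² i = trans (^-congʳ q (≡.sym (expo i))) (*-congˡ (trans (^-homo-* q (i ℕ.* i) (i ℕ.+ i))
            (*-congˡ (trans (^-homo-* q i i) (sym (^-distrib q q i))))))
          combine : ∀ i j → i ℕ.+ j ≡ n → f₁ i (suc j) + f₂ (suc i) j
            ≈ q * (1# - (q * q) ^ n) * (ε ^ i * q ^ (i ℕ.* i) * v i * (q ^ j * v j))
          combine i j e = begin
            f₁ i (suc j) + f₂ (suc i) j ≈⟨ +-cong (*-congˡ (V.step j)) (*-cong (*-congʳ (*-congʳ (*-congʳ (*-congˡ (q^[1+i]² i))))) (V.step i)) ⟩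
            ε ^ i * q ^ (i ℕ.* i) * v i * (q * q ^ j) * v j + ε * ε ^ i * (q * (q ^ (i ℕ.* i) * (q * q) ^ i)) * (q * q) ^ j * q ^ j * v j * v i
              ≈⟨ solve 8 (λ a b s x y vi vj q → s :* x :* vi :* (q :* y) :* vj :+ :- :1 :* s :* (q :* (x :* a)) :* b :* y :* vj :* vi
                   := q :* (:1 :- a :* b) :* (s :* x :* vi :* (y :* vj))) refl _ _ _ _ _ _ _ _ ⟩
            q * (1# - (q * q) ^ i * (q * q) ^ j) * (ε ^ i * q ^ (i ℕ.* i) * v i * (q ^ j * v j))
              ≈⟨ *-congʳ (*-congˡ (+-congˡ (-‿cong (^-merge (q * q) i j e)))) ⟩
            q * (1# - (q * q) ^ n) * (ε ^ i * q ^ (i ℕ.* i) * v i * (q ^ j * v j)) ∎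
        vanish : ∀ n → q * (1# - (q * q) ^ n) * f n ≈ 0#
        vanish zero = trans (*-assoc _ _ _) (trans (*-congˡ ([1-1]* _)) (zeroʳ _))
        vanish (suc n) = trans (*-assoc _ _ _) (trans (*-congˡ (trans (f-step n) (vanish n))) (zeroʳ _))

      gauss-bailey-pair : ∀ n → diag (λ m j → q ^ (m ℕ.* (m ℕ.+ 0)) * fold-sign m * u j * u (double m ℕ.+ j)) n ≈ v n
      gauss-bailey-pair n = begin
        diag (λ m j → q ^ (m ℕ.* (m ℕ.+ 0)) * fold-sign m * u j * u (double m ℕ.+ j)) n ≈⟨ bailey rec 0 fold-sign n ⟨
        diag (λ s k → q ^ (s ℕ.* (s ℕ.+ 0)) * diag (λ m j → fold-sign m * u j * u (double m ℕ.+ j)) s * u k) n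
          ≈⟨ diag-cong n (λ s k _ → expand s k) ⟩
        diag (λ s k → diag (λ i j → f s i j) k) n ≈⟨ diag-assoc f n ⟨
        diag (λ s k → diag (λ i j → f i j k) s) n ≈⟨ diag-cong n (λ s k _ → sym (diag-* (v k) _ s)) ⟩
        diag (λ s k → diag (λ i j → ε ^ i * q ^ (i ℕ.* i) * v i * (q ^ j * v j)) s * v k) n
          ≈⟨ diag-head n (λ s k → trans (*-congʳ (euler-inverse s)) (zeroˡ _)) ⟩
        1# * 1# * v 0 * (1# * v 0) * v n ≈⟨ *-congʳ (*-cong (*-congˡ V.u0) (*-congˡ V.u0)) ⟩
        1# * 1# * 1# * (1# * 1#) * v n ≈⟨ solve 1 (λ x → :1 :* :1 :* :1 :* (:1 :* :1) :* x := x) refl _ ⟩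
        v n ∎
        where
        f : ℕ → ℕ → ℕ → Carrier
        f s i j = ε ^ s * q ^ (s ℕ.* s) * v s * (q ^ i * v i) * v j
        fold-term : ∀ s m j → m ℕ.+ j ≡ s → fold-sign m * u j * u (double m ℕ.+ j) ≈ ε ^ s * fold (λ i j → ε ^ i * u i * u j) m j
        fold-term s zero .s ≡.refl = begin
          1# * u s * u s ≈⟨ *-congʳ (*-congʳ (ε²≈1 s)) ⟨
          ε ^ s * ε ^ s * u s * u s ≈⟨ solve 2 (λ s u → s :* s :* u :* u := s :* (s :* u :* u)) refl _ _ ⟩
          ε ^ s * (ε ^ s * u s * u s) ∎
        fold-term s m@(suc _) j e = begin
          (ε ^ m + ε ^ m) * u j * u (double m ℕ.+ j)
            ≈⟨ solve 3 (λ m u w → (m :+ m) :* u :* w := m :* (:1 :* (:1 :* u :* w) :+ :1 :* u :* w)) refl (ε ^ m) (u j) (u (double m ℕ.+ j)) ⟩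
          ε ^ m * (1# * (1# * u j * u (double m ℕ.+ j)) + 1# * u j * u (double m ℕ.+ j))
            ≈⟨ *-congˡ (+-cong (*-cong (ε^double m) (*-congʳ (*-congʳ (ε²≈1 j)))) (*-congʳ (*-congʳ (ε²≈1 j)))) ⟨
          ε ^ m * (ε ^ double m * (ε ^ j * ε ^ j * u j * u (double m ℕ.+ j)) + ε ^ j * ε ^ j * u j * u (double m ℕ.+ j))
            ≈⟨ solve 5 (λ m d j u w → m :* (d :* (j :* j :* u :* w) :+ j :* j :* u :* w) := m :* j :* (d :* j :* w :* u :+ j :* u :* w))
                 refl (ε ^ m) (ε ^ double m) (ε ^ j) (u j) (u (double m ℕ.+ j)) ⟩
          ε ^ m * ε ^ j * (ε ^ double m * ε ^ j * u (double m ℕ.+ j) * u j + ε ^ j * u j * u (double m ℕ.+ j))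
            ≈⟨ *-cong (^-merge ε m j e) (+-congʳ (*-congʳ (*-congʳ (sym (^-homo-* ε (double m) j))))) ⟩
          ε ^ s * fold (λ i j → ε ^ i * u i * u j) m j ∎
        β : ∀ s → diag (λ m j → fold-sign m * u j * u (double m ℕ.+ j)) s ≈ ε ^ s * v s
        β s = begin
          diag (λ m j → fold-sign m * u j * u (double m ℕ.+ j)) s ≈⟨ diag-cong s (fold-term s) ⟩
          diag (λ m j → ε ^ s * fold (λ i j → ε ^ i * u i * u j) m j) s ≈⟨ *-diag _ _ s ⟨
          ε ^ s * diag (fold (λ i j → ε ^ i * u i * u j)) s ≈⟨ *-congˡ (diag-double _ s) ⟨
          ε ^ s * diag (λ i j → ε ^ i * u i * u j) (double s) ≈⟨ *-congˡ (gauss-even s) ⟩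
          ε ^ s * v s ∎
        expand : ∀ s k → q ^ (s ℕ.* (s ℕ.+ 0)) * diag (λ m j → fold-sign m * u j * u (double m ℕ.+ j)) s * u k ≈ diag (λ i j → f s i j) k
        expand s k = begin
          q ^ (s ℕ.* (s ℕ.+ 0)) * diag (λ m j → fold-sign m * u j * u (double m ℕ.+ j)) s * u k
            ≈⟨ *-cong (*-cong (^-congʳ q (≡.cong (s ℕ.*_) (ℕₚ.+-identityʳ s))) (β s)) (sym (gauss-q k)) ⟩
          q ^ (s ℕ.* s) * (ε ^ s * v s) * diag (λ i j → q ^ i * v i * v j) k ≈⟨ *-diag _ _ k ⟩
          diag (λ i j → q ^ (s ℕ.* s) * (ε ^ s * v s) * (q ^ i * v i * v j)) k
            ≈⟨ diag-cong k (λ i j _ → solve 6 (λ a s vs b vi vj → a :* (s :* vs) :* (b :* vi :* vj) := s :* a :* vs :* (b :* vi) :* vj) refl _ _ _ _ _ _) ⟩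
          diag (λ i j → f s i j) k ∎

tri-+ : ∀ m n → tri (m ℕ.+ n) ≡ tri m ℕ.+ tri n ℕ.+ m ℕ.* n
tri-+ zero n = ≡.sym (ℕₚ.+-identityʳ (tri n))
tri-+ (suc m) n = ≡.trans (≡.cong (m ℕ.+ n ℕ.+_) (tri-+ m n)) (lemma m n (tri m) (tri n))
  where
  lemma : ∀ m n a b → m ℕ.+ n ℕ.+ (a ℕ.+ b ℕ.+ m ℕ.* n) ≡ m ℕ.+ a ℕ.+ b ℕ.+ suc m ℕ.* n
  lemma = solve-∀

tri-square : ∀ m → m ℕ.+ (tri m ℕ.+ tri m) ≡ m ℕ.* m
tri-square zero = ≡.refl
tri-square (suc m) = ≡.trans (lemma₁ m (tri m)) (≡.trans (≡.cong (λ k → k ℕ.+ suc (m ℕ.+ m)) (tri-square m)) (lemma₂ m))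
  where
  lemma₁ : ∀ m a → suc m ℕ.+ (m ℕ.+ a ℕ.+ (m ℕ.+ a)) ≡ m ℕ.+ (a ℕ.+ a) ℕ.+ suc (m ℕ.+ m)
  lemma₁ = solve-∀
  lemma₂ : ∀ m → m ℕ.* m ℕ.+ suc (m ℕ.+ m) ≡ suc m ℕ.* suc m
  lemma₂ = solve-∀

module Products (R : CommutativeRing 0ℓ 0ℓ) where
  open CommutativeRing R renaming (zero to *-zero)
  open IntegerCoefficients R
  open DiagonalSums R
  open QSeries R
  open Gauss R
  open import Algebra.Properties.Semiring.Exp semiring
  open import Relation.Binary.Reasoning.Setoid setoid

  factors : Carrier → Carrier → Carrier → ℕ → Carrier
  factors q x y zero = 1#
  factors q x y (suc n) = factors q x y n * (y - x * q ^ n)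

  factors-cong : ∀ q {x x′ y y′} n → x ≈ x′ → y ≈ y′ → factors q x y n ≈ factors q x′ y′ n
  factors-cong q zero ex ey = refl
  factors-cong q (suc n) ex ey = *-cong (factors-cong q n ex ey) (+-cong ey (-‿cong (*-congʳ ex)))

  factors-+ : ∀ q x y a b → factors q x y (a ℕ.+ b) ≈ factors q x y a * factors q (x * q ^ a) y b
  factors-+ q x y a zero = trans (reflexive (≡.cong (factors q x y) (ℕₚ.+-identityʳ a))) (sym (*-identityʳ _))
  factors-+ q x y a (suc b) = begin
    factors q x y (a ℕ.+ suc b) ≡⟨ ≡.cong (factors q x y) (ℕₚ.+-suc a b) ⟩
    factors q x y (a ℕ.+ b) * (y - x * q ^ (a ℕ.+ b))
      ≈⟨ *-cong (factors-+ q x y a b) (+-congˡ (-‿cong (trans (*-congˡ (^-homo-* q a b)) (sym (*-assoc x _ _))))) ⟩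
    factors q x y a * factors q (x * q ^ a) y b * (y - x * q ^ a * q ^ b) ≈⟨ *-assoc _ _ _ ⟩
    factors q x y a * factors q (x * q ^ a) y (suc b) ∎

  factors-scale : ∀ q z x y n → factors q (z * x) (z * y) n ≈ z ^ n * factors q x y n
  factors-scale q z x y zero = sym (*-identityˡ _)
  factors-scale q z x y (suc n) = trans (*-congʳ (factors-scale q z x y n))
    (solve 6 (λ z x y a f b → a :* f :* (z :* y :- z :* x :* b) := z :* a :* (f :* (y :- x :* b))) refl z x y (z ^ n) (factors q x y n) (q ^ n))

  factors-1 : ∀ q x n → factors q x 1# n ≈ x ⨾ q ⟨ n ⟩
  factors-1 q x zero = refl
  factors-1 q x (suc n) = *-congʳ (factors-1 q x n)

  ⨾-+ : ∀ q x a b → x ⨾ q ⟨ a ℕ.+ b ⟩ ≈ x ⨾ q ⟨ a ⟩ * (x * q ^ a) ⨾ q ⟨ b ⟩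
  ⨾-+ q x a b = trans (sym (factors-1 q x (a ℕ.+ b))) (trans (factors-+ q x 1# a b)
    (*-cong (factors-1 q x a) (factors-1 q (x * q ^ a) b)))

  -- (−1)ᵐ q^(m(m−1)/2) xᵐ with m and −m merged, where w = q/x.
  theta : Carrier → Carrier → Carrier → ℕ → Carrier
  theta q x w zero = 1#
  theta q x w (suc m) = ε ^ suc m * q ^ tri (suc m) * (x ^ suc m + w ^ suc m)

  1^n : ∀ n → 1# ^ n ≈ 1#
  1^n zero = refl
  1^n (suc n) = trans (*-identityˡ _) (1^n n)

  cancel-^ : ∀ {y : Carrier} → (∀ {a b} → y * a ≈ y * b → a ≈ b) → ∀ n {a b} → y ^ n * a ≈ y ^ n * b → a ≈ b
  cancel-^ h zero e = trans (sym (*-identityˡ _)) (trans e (*-identityˡ _))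
  cancel-^ h (suc n) e = cancel-^ h n (h (trans (sym (*-assoc _ _ _)) (trans e (*-assoc _ _ _))))

  module _ {q : Carrier} {u : ℕ → Carrier} (rec : Reciprocal q u) where
    open Reciprocal rec

    q-binomial : ∀ x y n → diag (λ i j → ε ^ i * q ^ tri i * x ^ i * u i * (y ^ j * u j)) n ≈ u n * factors q x y n
    q-binomial x y zero = trans (*-congˡ (*-congˡ u0)) (solve 1 (λ u → :1 :* :1 :* :1 :* u :* (:1 :* :1) := u :* :1) refl _)
    q-binomial x y (suc n) = cancel rec n (begin
      (1# - q ^ suc n) * diag f (suc n) ≈⟨ *-diag _ f (suc n) ⟩
      diag (λ i j → (1# - q ^ suc n) * f i j) (suc n)
        ≈⟨ diag-split f₁ f₂ n split (λ i → trans (*-congˡ ([1-1]* _)) (zeroʳ _)) (λ j → trans (*-congˡ ([1-1]* _)) (zeroʳ _)) ⟩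
      diag (λ i j → f₁ i (suc j) + f₂ (suc i) j) n ≈⟨ diag-cong n combine ⟩
      diag (λ i j → (y - x * q ^ n) * f i j) n ≈⟨ *-diag _ f n ⟨
      (y - x * q ^ n) * diag f n ≈⟨ *-congˡ (q-binomial x y n) ⟩
      (y - x * q ^ n) * (u n * factors q x y n) ≈⟨ *-congˡ (*-congʳ (step n)) ⟨
      (y - x * q ^ n) * ((1# - q ^ suc n) * u (suc n) * factors q x y n)
        ≈⟨ solve 4 (λ a b c d → a :* (b :* c :* d) := b :* (c :* (d :* a))) refl _ _ _ _ ⟩
      (1# - q ^ suc n) * (u (suc n) * factors q x y (suc n)) ∎)
      where
      f f₁ f₂ : ℕ → ℕ → Carrier
      f i j = ε ^ i * q ^ tri i * x ^ i * u i * (y ^ j * u j)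
      f₁ i j = ε ^ i * q ^ tri i * x ^ i * u i * y ^ j * ((1# - q ^ j) * u j)
      f₂ i j = ε ^ i * q ^ tri i * x ^ i * y ^ j * u j * q ^ j * ((1# - q ^ i) * u i)
      split : ∀ i j → i ℕ.+ j ≡ suc n → (1# - q ^ suc n) * f i j ≈ f₁ i j + f₂ i j
      split i j e = trans (*-congʳ (+-congˡ (-‿cong (^-split q i j e))))
        (solve 8 (λ a b s t x y ui uj → (:1 :- a :* b) :* (s :* t :* x :* ui :* (y :* uj))
          := s :* t :* x :* ui :* y :* ((:1 :- b) :* uj) :+ s :* t :* x :* y :* uj :* b :* ((:1 :- a) :* ui)) refl _ _ _ _ _ _ _ _)
      combine : ∀ i j → i ℕ.+ j ≡ n → f₁ i (suc j) + f₂ (suc i) j ≈ (y - x * q ^ n) * f i j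
      combine i j e = begin
        f₁ i (suc j) + f₂ (suc i) j
          ≈⟨ +-cong (*-congˡ (step j)) (*-cong (*-congʳ (*-congʳ (*-congʳ (*-congʳ (*-congˡ (^-homo-* q i (tri i))))))) (step i)) ⟩
        ε ^ i * q ^ tri i * x ^ i * u i * (y * y ^ j) * u j + ε * ε ^ i * (q ^ i * q ^ tri i) * (x * x ^ i) * y ^ j * u j * q ^ j * u i
          ≈⟨ solve 10 (λ a b s t x y xi yj ui uj → s :* t :* xi :* ui :* (y :* yj) :* uj :+ :- :1 :* s :* (a :* t) :* (x :* xi) :* yj :* uj :* b :* ui
               := (y :- x :* (a :* b)) :* (s :* t :* xi :* ui :* (yj :* uj))) refl _ _ _ _ _ _ _ _ _ _ ⟩
        (y - x * (q ^ i * q ^ j)) * f i j ≈⟨ *-congʳ (+-congˡ (-‿cong (*-congˡ (^-merge q i j e)))) ⟩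
        (y - x * q ^ n) * f i j ∎

    module _ {x w : Carrier} (xw≈q : x * w ≈ q) where
      private
        -- The common monomial produced when y = qⁿ clears the negative powers of q.
        K : ℕ → Carrier
        K n = ε ^ n * x ^ n * q ^ tri n * q ^ (n ℕ.* n)

        lower : ∀ n → factors q x (q ^ n) n ≈ ε ^ n * x ^ n * q ^ tri n * w ⨾ q ⟨ n ⟩
        lower zero = solve 0 (:1 := :1 :* :1 :* :1 :* :1) refl
        lower (suc n) = begin
          factors q x (q ^ suc n) (1 ℕ.+ n) ≈⟨ factors-+ q x (q ^ suc n) 1 n ⟩
          1# * (q ^ suc n - x * 1#) * factors q (x * (q * 1#)) (q ^ suc n) n
            ≈⟨ *-congˡ (trans (factors-cong q n (solve 2 (λ x q → x :* (q :* :1) := q :* x) refl x q) refl) (factors-scale q q x (q ^ n) n)) ⟩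
          1# * (q * q ^ n - x * 1#) * (q ^ n * factors q x (q ^ n) n)
            ≈⟨ *-cong (*-congˡ (+-congʳ (*-congʳ (sym xw≈q)))) (*-congˡ (lower n)) ⟩
          1# * (x * w * q ^ n - x * 1#) * (q ^ n * (ε ^ n * x ^ n * q ^ tri n * w ⨾ q ⟨ n ⟩))
            ≈⟨ solve 7 (λ x w a s xn t p → :1 :* (x :* w :* a :- x :* :1) :* (a :* (s :* xn :* t :* p))
                 := :- :1 :* s :* (x :* xn) :* (a :* t) :* (p :* (:1 :- w :* a))) refl _ _ _ _ _ _ _ ⟩
          ε * ε ^ n * (x * x ^ n) * (q ^ n * q ^ tri n) * (w ⨾ q ⟨ n ⟩ * (1# - w * q ^ n))
            ≈⟨ *-congʳ (*-congˡ (sym (^-homo-* q n (tri n)))) ⟩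
          ε ^ suc n * x ^ suc n * q ^ tri (suc n) * w ⨾ q ⟨ suc n ⟩ ∎

        upper : ∀ n → factors q (x * q ^ n) (q ^ n) n ≈ q ^ (n ℕ.* n) * x ⨾ q ⟨ n ⟩
        upper n = begin
          factors q (x * q ^ n) (q ^ n) n ≈⟨ factors-cong q n (*-comm _ _) (sym (*-identityʳ _)) ⟩
          factors q (q ^ n * x) (q ^ n * 1#) n ≈⟨ factors-scale q (q ^ n) x 1# n ⟩
          (q ^ n) ^ n * factors q x 1# n ≈⟨ *-cong (^-assocʳ q n n) (factors-1 q x n) ⟩
          q ^ (n ℕ.* n) * x ⨾ q ⟨ n ⟩ ∎

        product : ∀ n → factors q x (q ^ n) (double n) ≈ K n * (x ⨾ q ⟨ n ⟩ * w ⨾ q ⟨ n ⟩)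
        product n = begin
          factors q x (q ^ n) (double n) ≡⟨ ≡.cong (factors q x (q ^ n)) (double≡+ n) ⟩
          factors q x (q ^ n) (n ℕ.+ n) ≈⟨ factors-+ q x (q ^ n) n n ⟩
          factors q x (q ^ n) n * factors q (x * q ^ n) (q ^ n) n ≈⟨ *-cong (lower n) (upper n) ⟩
          ε ^ n * x ^ n * q ^ tri n * w ⨾ q ⟨ n ⟩ * (q ^ (n ℕ.* n) * x ⨾ q ⟨ n ⟩)
            ≈⟨ solve 4 (λ a b c d → a :* b :* (c :* d) := a :* c :* (d :* b)) refl _ _ _ _ ⟩
          K n * (x ⨾ q ⟨ n ⟩ * w ⨾ q ⟨ n ⟩) ∎

        f : ℕ → ℕ → ℕ → Carrier
        f n i j = ε ^ i * q ^ tri i * x ^ i * u i * ((q ^ n) ^ j * u j)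

        ε^[2m+j] : ∀ m j → ε ^ (double m ℕ.+ j) ≈ ε ^ j
        ε^[2m+j] m j = trans (^-homo-* ε (double m) j) (trans (*-congʳ (ε^double m)) (*-identityˡ _))

        index : ∀ m j → double m ℕ.+ j ≡ m ℕ.+ (m ℕ.+ j)
        index m j = ≡.trans (≡.cong (ℕ._+ j) (double≡+ m)) (ℕₚ.+-assoc m m j)

        right : ∀ m j → let n = m ℕ.+ j in
          f n (double m ℕ.+ j) j ≈ K n * (ε ^ m * q ^ tri m * x ^ m * u j * u (double m ℕ.+ j))
        right m j = begin
          ε ^ k * q ^ tri k * x ^ k * u k * ((q ^ n) ^ j * u j)
            ≈⟨ *-cong (*-congʳ (*-cong (*-congʳ (^-split ε m n (≡.sym (index m j)))) (^-split x m n (≡.sym (index m j)))))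
                      (*-congʳ (^-assocʳ q n j)) ⟩
          ε ^ m * ε ^ n * q ^ tri k * (x ^ m * x ^ n) * u k * (q ^ (n ℕ.* j) * u j)
            ≈⟨ solve 8 (λ em en t xm xn uk r uj → em :* en :* t :* (xm :* xn) :* uk :* (r :* uj)
                 := em :* en :* (xm :* xn) :* uk :* uj :* (t :* r)) refl _ _ _ _ _ _ _ _ ⟩
          ε ^ m * ε ^ n * (x ^ m * x ^ n) * u k * u j * (q ^ tri k * q ^ (n ℕ.* j))
            ≈⟨ *-congˡ (trans (^-merge q (tri k) (n ℕ.* j) expo)
                 (trans (^-homo-* q (tri m) (tri n ℕ.+ n ℕ.* n)) (*-congˡ (^-homo-* q (tri n) (n ℕ.* n))))) ⟩
          ε ^ m * ε ^ n * (x ^ m * x ^ n) * u k * u j * (q ^ tri m * (q ^ tri n * q ^ (n ℕ.* n)))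
            ≈⟨ solve 9 (λ em en xm xn uk uj tm tn r → em :* en :* (xm :* xn) :* uk :* uj :* (tm :* (tn :* r))
                 := en :* xn :* tn :* r :* (em :* tm :* xm :* uj :* uk)) refl _ _ _ _ _ _ _ _ _ ⟩
          K n * (ε ^ m * q ^ tri m * x ^ m * u j * u k) ∎
          where
          n = m ℕ.+ j
          k = double m ℕ.+ j
          arith : ∀ m j a b → a ℕ.+ b ℕ.+ m ℕ.* (m ℕ.+ j) ℕ.+ (m ℕ.+ j) ℕ.* j ≡ a ℕ.+ (b ℕ.+ (m ℕ.+ j) ℕ.* (m ℕ.+ j))
          arith = solve-∀
          expo : tri k ℕ.+ n ℕ.* j ≡ tri m ℕ.+ (tri n ℕ.+ n ℕ.* n)
          expo = ≡.trans (≡.cong (ℕ._+ n ℕ.* j) (≡.trans (≡.cong tri (index m j)) (tri-+ m n))) (arith m j (tri m) (tri n))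

        left : ∀ m j → let n = m ℕ.+ j in
          f n j (double m ℕ.+ j) ≈ K n * (ε ^ m * q ^ tri m * w ^ m * u j * u (double m ℕ.+ j))
        left m j = begin
          ε ^ j * q ^ tri j * x ^ j * u j * ((q ^ n) ^ k * u k)
            ≈⟨ *-cong (*-congʳ (*-congʳ (*-congʳ (trans (sym (ε^[2m+j] m j)) (^-split ε m n (≡.sym (index m j)))))))
                      (*-congʳ (^-assocʳ q n k)) ⟩
          ε ^ m * ε ^ n * q ^ tri j * x ^ j * u j * (q ^ (n ℕ.* k) * u k)
            ≈⟨ solve 7 (λ em en t xj uj r uk → em :* en :* t :* xj :* uj :* (r :* uk) := em :* en :* xj :* uk :* uj :* (t :* r)) refl _ _ _ _ _ _ _ ⟩
          ε ^ m * ε ^ n * x ^ j * u k * u j * (q ^ tri j * q ^ (n ℕ.* k))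
            ≈⟨ *-congˡ (trans (^-merge q (tri j) (n ℕ.* k) expo) (trans (^-homo-* q m _)
                 (*-congˡ (trans (^-homo-* q (tri m) (tri n ℕ.+ n ℕ.* n)) (*-congˡ (^-homo-* q (tri n) (n ℕ.* n))))))) ⟩
          ε ^ m * ε ^ n * x ^ j * u k * u j * (q ^ m * (q ^ tri m * (q ^ tri n * q ^ (n ℕ.* n))))
            ≈⟨ *-congˡ (*-congʳ (trans (^-congˡ m (sym xw≈q)) (^-distrib x w m))) ⟩
          ε ^ m * ε ^ n * x ^ j * u k * u j * (x ^ m * w ^ m * (q ^ tri m * (q ^ tri n * q ^ (n ℕ.* n))))
            ≈⟨ solve 10 (λ em en xj uk uj xm wm tm tn r → em :* en :* xj :* uk :* uj :* (xm :* wm :* (tm :* (tn :* r)))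
                 := en :* (xm :* xj) :* tn :* r :* (em :* tm :* wm :* uj :* uk)) refl _ _ _ _ _ _ _ _ _ _ ⟩
          ε ^ n * (x ^ m * x ^ j) * q ^ tri n * q ^ (n ℕ.* n) * (ε ^ m * q ^ tri m * w ^ m * u j * u k)
            ≈⟨ *-congʳ (*-congʳ (*-congʳ (*-congˡ (sym (^-homo-* x m j))))) ⟩
          K n * (ε ^ m * q ^ tri m * w ^ m * u j * u k) ∎
          where
          n = m ℕ.+ j
          k = double m ℕ.+ j
          arith₁ : ∀ m j b → b ℕ.+ (m ℕ.+ j) ℕ.* (m ℕ.+ (m ℕ.+ j)) ≡ m ℕ.* m ℕ.+ (b ℕ.+ m ℕ.* j ℕ.+ (m ℕ.+ j) ℕ.* (m ℕ.+ j))
          arith₁ = solve-∀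
          arith₂ : ∀ m j a b n² → m ℕ.+ (a ℕ.+ a) ℕ.+ (b ℕ.+ m ℕ.* j ℕ.+ n²) ≡ m ℕ.+ (a ℕ.+ (a ℕ.+ b ℕ.+ m ℕ.* j ℕ.+ n²))
          arith₂ = solve-∀
          expo : tri j ℕ.+ n ℕ.* k ≡ m ℕ.+ (tri m ℕ.+ (tri n ℕ.+ n ℕ.* n))
          expo = ≡.trans (≡.cong (λ k → tri j ℕ.+ n ℕ.* k) (index m j)) (≡.trans (arith₁ m j (tri j))
            (≡.trans (≡.cong (λ s → s ℕ.+ (tri j ℕ.+ m ℕ.* j ℕ.+ n ℕ.* n)) (≡.sym (tri-square m)))
            (≡.trans (arith₂ m j (tri m) (tri j) (n ℕ.* n))
              (≡.cong (λ t → m ℕ.+ (tri m ℕ.+ (t ℕ.+ n ℕ.* n))) (≡.sym (tri-+ m j))))))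

        folded : ∀ n m j → m ℕ.+ j ≡ n → fold (f n) m j ≈ K n * (theta q x w m * u j * u (double m ℕ.+ j))
        folded n zero .n ≡.refl = trans (*-congˡ (*-congʳ (^-assocʳ q n n)))
          (solve 5 (λ e t x u r → e :* t :* x :* u :* (r :* u) := e :* x :* t :* r :* (:1 :* u :* u)) refl _ _ _ _ _)
        folded .(m ℕ.+ j) m@(suc _) j ≡.refl = trans (+-cong (right m j) (left m j))
          (solve 7 (λ K e t x w uj uk → K :* (e :* t :* x :* uj :* uk) :+ K :* (e :* t :* w :* uj :* uk)
            := K :* (e :* t :* (x :+ w) :* uj :* uk)) refl (K (m ℕ.+ j)) (ε ^ m) (q ^ tri m) (x ^ m) (w ^ m) (u j) (u (double m ℕ.+ j)))

      jacobi-triple : (∀ {a b} → x * a ≈ x * b → a ≈ b) → (∀ {a b} → q * a ≈ q * b → a ≈ b) → ∀ n →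
        diag (λ m j → theta q x w m * u j * u (double m ℕ.+ j)) n ≈ u (double n) * (x ⨾ q ⟨ n ⟩ * w ⨾ q ⟨ n ⟩)
      jacobi-triple x-cancel q-cancel n = cancel-K (begin
        K n * diag (λ m j → theta q x w m * u j * u (double m ℕ.+ j)) n ≈⟨ *-diag _ _ n ⟩
        diag (λ m j → K n * (theta q x w m * u j * u (double m ℕ.+ j))) n ≈⟨ diag-cong n (folded n) ⟨
        diag (fold (f n)) n ≈⟨ diag-double (f n) n ⟨
        diag (f n) (double n) ≈⟨ q-binomial x (q ^ n) (double n) ⟩
        u (double n) * factors q x (q ^ n) (double n) ≈⟨ *-congˡ (product n) ⟩
        u (double n) * (K n * (x ⨾ q ⟨ n ⟩ * w ⨾ q ⟨ n ⟩)) ≈⟨ solve 3 (λ a b c → a :* (b :* c) := b :* (a :* c)) refl _ _ _ ⟩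
        K n * (u (double n) * (x ⨾ q ⟨ n ⟩ * w ⨾ q ⟨ n ⟩)) ∎)
        where
        assoc₄ : ∀ a → K n * a ≈ ε ^ n * (x ^ n * (q ^ tri n * (q ^ (n ℕ.* n) * a)))
        assoc₄ a = solve 5 (λ e x t r a → e :* x :* t :* r :* a := e :* (x :* (t :* (r :* a)))) refl _ _ _ _ _
        cancel-K : ∀ {a b} → K n * a ≈ K n * b → a ≈ b
        cancel-K {a} {b} e = cancel-^ q-cancel (n ℕ.* n) (cancel-^ q-cancel (tri n) (cancel-^ x-cancel n
          (cancel-unit (ε²≈1 n) (trans (sym (assoc₄ a)) (trans e (assoc₄ b))))))

  module _ {q : Carrier} {u v w : ℕ → Carrier} (rec : Reciprocal q u) (rec² : Reciprocal (q * q) v)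
           (rec⁴ : Reciprocal (q * q * (q * q)) w) where
    private
      Q = q * q
      M : ℕ → Carrier
      M n = (- Q) ⨾ Q ⟨ n ⟩

    M*w≈v : ∀ n → M n * w n ≈ v n
    M*w≈v = unique rec² (trans (*-identityˡ _) (Reciprocal.u0 rec⁴)) λ n → begin
      (1# - Q * Q ^ n) * (M n * (1# - (- Q) * Q ^ n) * w (suc n))
        ≈⟨ solve 4 (λ Q a m w → (:1 :- Q :* a) :* (m :* (:1 :- (:- Q) :* a) :* w) := m :* ((:1 :- Q :* Q :* (a :* a)) :* w)) refl Q (Q ^ n) (M n) (w (suc n)) ⟩
      M n * ((1# - Q * Q * (Q ^ n * Q ^ n)) * w (suc n)) ≈⟨ *-congˡ (*-congʳ (+-congˡ (-‿cong (*-congˡ (sym (^-distrib Q Q n)))))) ⟩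
      M n * ((1# - (Q * Q) ^ suc n) * w (suc n)) ≈⟨ *-congˡ (Reciprocal.step rec⁴ n) ⟩
      M n * w n ∎

    private
      tail : ∀ n d → (- Q * Q ^ n) ⨾ Q ⟨ d ⟩ * v d ≈ diag (λ k l → q ^ (k ℕ.+ k ℕ.* k ℕ.+ 2 ℕ.* n ℕ.* k) * v k * v l) d
      tail n d = begin
        x ⨾ Q ⟨ d ⟩ * v d ≈⟨ trans (*-comm _ _) (*-congˡ (sym (factors-1 Q x d))) ⟩
        v d * factors Q x 1# d ≈⟨ q-binomial rec² x 1# d ⟨
        diag (λ i j → ε ^ i * Q ^ tri i * x ^ i * v i * (1# ^ j * v j)) d ≈⟨ diag-cong d (λ k l _ → *-cong (*-congʳ (term k)) (trans (*-congʳ (1^n l)) (*-identityˡ _))) ⟩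
        diag (λ k l → q ^ (k ℕ.+ k ℕ.* k ℕ.+ 2 ℕ.* n ℕ.* k) * v k * v l) d ∎
        where
        x = - Q * Q ^ n
        expo : ∀ n k → (tri k ℕ.+ suc n ℕ.* k) ℕ.+ (tri k ℕ.+ suc n ℕ.* k) ≡ k ℕ.+ k ℕ.* k ℕ.+ 2 ℕ.* n ℕ.* k
        expo n k = ≡.trans (arith n k (tri k)) (≡.cong (λ s → k ℕ.+ s ℕ.+ 2 ℕ.* n ℕ.* k) (tri-square k))
          where
          arith : ∀ n k t → (t ℕ.+ suc n ℕ.* k) ℕ.+ (t ℕ.+ suc n ℕ.* k) ≡ k ℕ.+ (k ℕ.+ (t ℕ.+ t)) ℕ.+ 2 ℕ.* n ℕ.* k
          arith = solve-∀
        term : ∀ k → ε ^ k * Q ^ tri k * x ^ k ≈ q ^ (k ℕ.+ k ℕ.* k ℕ.+ 2 ℕ.* n ℕ.* k)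
        term k = begin
          ε ^ k * Q ^ tri k * x ^ k ≈⟨ *-congˡ (trans (^-congˡ k (solve 2 (λ Q a → (:- Q) :* a := :- :1 :* (Q :* a)) refl Q (Q ^ n))) (^-distrib ε (Q ^ suc n) k)) ⟩
          ε ^ k * Q ^ tri k * (ε ^ k * (Q ^ suc n) ^ k) ≈⟨ solve 3 (λ e t r → e :* t :* (e :* r) := e :* e :* (t :* r)) refl _ _ _ ⟩
          ε ^ k * ε ^ k * (Q ^ tri k * (Q ^ suc n) ^ k) ≈⟨ *-cong (ε²≈1 k) (*-congˡ (^-assocʳ Q (suc n) k)) ⟩
          1# * (Q ^ tri k * Q ^ (suc n ℕ.* k)) ≈⟨ trans (*-identityˡ _) (sym (^-homo-* Q (tri k) (suc n ℕ.* k))) ⟩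
          Q ^ (tri k ℕ.+ suc n ℕ.* k) ≈⟨ ^-distrib q q (tri k ℕ.+ suc n ℕ.* k) ⟩
          q ^ (tri k ℕ.+ suc n ℕ.* k) * q ^ (tri k ℕ.+ suc n ℕ.* k) ≈⟨ ^-merge q (tri k ℕ.+ suc n ℕ.* k) (tri k ℕ.+ suc n ℕ.* k) (expo n k) ⟩
          q ^ (k ℕ.+ k ℕ.* k ℕ.+ 2 ℕ.* n ℕ.* k) ∎

      -- (−q²;q²)_N/(q⁴;q⁴)_n = (−q^(2n+2);q²)_(N−n)/(q²;q²)_n is expanded by the q-binomial
      -- theorem, and the resulting double sum is regrouped along n + k = s.
      reduce : ∀ e (a : ℕ → ℕ) →
        (∀ s → diag (λ n k → q ^ a n * q ^ (k ℕ.+ k ℕ.* k ℕ.+ 2 ℕ.* n ℕ.* k) * (v n * v k)) s ≈ q ^ (s ℕ.* (s ℕ.+ e)) * u s) →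
        ∀ N → M N * diag (λ n d → q ^ a n * w n * v d) N ≈ diag (λ s l → q ^ (s ℕ.* (s ℕ.+ e)) * u s * v l) N
      reduce e a h N = begin
        M N * diag (λ n d → q ^ a n * w n * v d) N ≈⟨ *-diag _ _ N ⟩
        diag (λ n d → M N * (q ^ a n * w n * v d)) N ≈⟨ diag-cong N split ⟩
        diag (λ n d → diag (f n) d) N ≈⟨ diag-assoc f N ⟨
        diag (λ s l → diag (λ n k → f n k l) s) N ≈⟨ diag-cong N (λ s l _ → trans (sym (diag-* (v l) _ s)) (*-congʳ (h s))) ⟩
        diag (λ s l → q ^ (s ℕ.* (s ℕ.+ e)) * u s * v l) N ∎
        where
        f : ℕ → ℕ → ℕ → Carrier
        f n k l = q ^ a n * q ^ (k ℕ.+ k ℕ.* k ℕ.+ 2 ℕ.* n ℕ.* k) * (v n * v k) * v l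
        split : ∀ n d → n ℕ.+ d ≡ N → M N * (q ^ a n * w n * v d) ≈ diag (f n) d
        split n d e = begin
          M N * (q ^ a n * w n * v d) ≈⟨ *-congʳ (trans (reflexive (≡.cong M (≡.sym e))) (⨾-+ Q (- Q) n d)) ⟩
          M n * x ⨾ Q ⟨ d ⟩ * (q ^ a n * w n * v d) ≈⟨ solve 5 (λ m p a w v → m :* p :* (a :* w :* v) := a :* (m :* w) :* (p :* v)) refl _ _ _ _ _ ⟩
          q ^ a n * (M n * w n) * (x ⨾ Q ⟨ d ⟩ * v d) ≈⟨ *-cong (*-congˡ (M*w≈v n)) (tail n d) ⟩
          q ^ a n * v n * diag (λ k l → q ^ (k ℕ.+ k ℕ.* k ℕ.+ 2 ℕ.* n ℕ.* k) * v k * v l) d ≈⟨ *-diag _ _ d ⟩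
          diag (λ k l → q ^ a n * v n * (q ^ (k ℕ.+ k ℕ.* k ℕ.+ 2 ℕ.* n ℕ.* k) * v k * v l)) d
            ≈⟨ diag-cong d (λ k l _ → solve 5 (λ a vn r vk vl → a :* vn :* (r :* vk :* vl) := a :* r :* (vn :* vk) :* vl) refl _ _ _ _ _) ⟩
          diag (f n) d ∎
          where x = - Q * Q ^ n

    reduce₀ : ∀ N → M N * diag (λ n d → q ^ (n ℕ.* n) * w n * v d) N ≈ diag (λ s l → q ^ (s ℕ.* (s ℕ.+ 0)) * u s * v l) N
    reduce₀ = reduce 0 (λ n → n ℕ.* n) λ s → begin
      diag (λ n k → q ^ (n ℕ.* n) * q ^ (k ℕ.+ k ℕ.* k ℕ.+ 2 ℕ.* n ℕ.* k) * (v n * v k)) s ≈⟨ diag-cong s (term s) ⟩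
      diag (λ n k → q ^ (s ℕ.* (s ℕ.+ 0)) * (q ^ k * v k * v n)) s ≈⟨ *-diag _ _ s ⟨
      q ^ (s ℕ.* (s ℕ.+ 0)) * diag (λ n k → q ^ k * v k * v n) s ≈⟨ *-congˡ (trans (diag-swap _ s) (gauss-q rec rec² s)) ⟩
      q ^ (s ℕ.* (s ℕ.+ 0)) * u s ∎
      where
      expo : ∀ n k → n ℕ.* n ℕ.+ (k ℕ.+ k ℕ.* k ℕ.+ 2 ℕ.* n ℕ.* k) ≡ (n ℕ.+ k) ℕ.* (n ℕ.+ k ℕ.+ 0) ℕ.+ k
      expo = solve-∀
      term : ∀ s n k → n ℕ.+ k ≡ s → q ^ (n ℕ.* n) * q ^ (k ℕ.+ k ℕ.* k ℕ.+ 2 ℕ.* n ℕ.* k) * (v n * v k) ≈ q ^ (s ℕ.* (s ℕ.+ 0)) * (q ^ k * v k * v n)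
      term s n k ≡.refl = trans (*-congʳ (trans (^-merge q (n ℕ.* n) _ (expo n k)) (^-homo-* q (s ℕ.* (s ℕ.+ 0)) k)))
        (solve 4 (λ a b c d → a :* b :* (c :* d) := a :* (b :* d :* c)) refl _ _ _ _)

    reduce₁ : ∀ N → M N * diag (λ n d → q ^ (n ℕ.* (n ℕ.+ 2)) * w n * v d) N ≈ diag (λ s l → q ^ (s ℕ.* (s ℕ.+ 1)) * u s * v l) N
    reduce₁ = reduce 1 (λ n → n ℕ.* (n ℕ.+ 2)) λ s → begin
      diag (λ n k → q ^ (n ℕ.* (n ℕ.+ 2)) * q ^ (k ℕ.+ k ℕ.* k ℕ.+ 2 ℕ.* n ℕ.* k) * (v n * v k)) s ≈⟨ diag-cong s (term s) ⟩
      diag (λ n k → q ^ (s ℕ.* (s ℕ.+ 1)) * (q ^ n * v n * v k)) s ≈⟨ *-diag _ _ s ⟨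
      q ^ (s ℕ.* (s ℕ.+ 1)) * diag (λ n k → q ^ n * v n * v k) s ≈⟨ *-congˡ (gauss-q rec rec² s) ⟩
      q ^ (s ℕ.* (s ℕ.+ 1)) * u s ∎
      where
      expo : ∀ n k → n ℕ.* (n ℕ.+ 2) ℕ.+ (k ℕ.+ k ℕ.* k ℕ.+ 2 ℕ.* n ℕ.* k) ≡ (n ℕ.+ k) ℕ.* (n ℕ.+ k ℕ.+ 1) ℕ.+ n
      expo = solve-∀
      term : ∀ s n k → n ℕ.+ k ≡ s → q ^ (n ℕ.* (n ℕ.+ 2)) * q ^ (k ℕ.+ k ℕ.* k ℕ.+ 2 ℕ.* n ℕ.* k) * (v n * v k) ≈ q ^ (s ℕ.* (s ℕ.+ 1)) * (q ^ n * v n * v k)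
      term s n k ≡.refl = trans (*-congʳ (trans (^-merge q (n ℕ.* (n ℕ.+ 2)) _ (expo n k)) (^-homo-* q (s ℕ.* (s ℕ.+ 1)) n)))
        (solve 4 (λ a b c d → a :* b :* (c :* d) := a :* (b :* c :* d)) refl _ _ _ _)

five : ℕ → ℕ
five zero = 0
five (suc n) = 5 ℕ.+ five n

n≤five : ∀ n → n ℕ.≤ five n
n≤five zero = ℕ.z≤n
n≤five (suc n) = ℕ.s≤s (ℕₚ.≤-trans (n≤five n) (ℕₚ.m≤n+m (five n) 4))

module Limits (R : CommutativeRing 0ℓ 0ℓ) (t : CommutativeRing.Carrier R) where
  open CommutativeRing R renaming (zero to *-zero)
  open IntegerCoefficients R
  open DiagonalSums R
  open QSeries R
  open Gauss R
  open import Algebra.Properties.Semiring.Exp semiring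
  open import Relation.Binary.Reasoning.Setoid setoid

  infix 4 _≃[_]_
  infix 3 _by_

  record _≃[_]_ (a : Carrier) (n : ℕ) (b : Carrier) : Set where
    constructor _by_
    field
      quotient : Carrier
      equation : a ≈ b + t ^ n * quotient

  ≈⇒≃ : ∀ {n a b} → a ≈ b → a ≃[ n ] b
  ≈⇒≃ e = 0# by trans e (sym (trans (+-congˡ (zeroʳ _)) (+-identityʳ _)))

  ≃-sym : ∀ {n a b} → a ≃[ n ] b → b ≃[ n ] a
  ≃-sym {n} {a} {b} (h by e) = (- h) by sym (trans (+-congʳ e) (solve 3 (λ b s h → b :+ s :* h :+ s :* (:- h) := b) refl b (t ^ n) h))

  ≃-trans : ∀ {n a b c} → a ≃[ n ] b → b ≃[ n ] c → a ≃[ n ] c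
  ≃-trans {n} {a} {b} {c} (h by e) (k by f) = (k + h) by trans e (trans (+-congʳ f)
    (solve 4 (λ c s k h → c :+ s :* k :+ s :* h := c :+ s :* (k :+ h)) refl c (t ^ n) k h))

  ≃-+ : ∀ {n a b c d} → a ≃[ n ] b → c ≃[ n ] d → a + c ≃[ n ] b + d
  ≃-+ {n} {a} {b} {c} {d} (h by e) (k by f) = (h + k) by trans (+-cong e f)
    (solve 5 (λ b d s h k → b :+ s :* h :+ (d :+ s :* k) := b :+ d :+ s :* (h :+ k)) refl b d (t ^ n) h k)

  ≃-*ˡ : ∀ {n a b} x → a ≃[ n ] b → x * a ≃[ n ] x * b
  ≃-*ˡ {n} {a} {b} x (h by e) = (x * h) by trans (*-congˡ e)
    (solve 4 (λ b s h x → x :* (b :+ s :* h) := x :* b :+ s :* (x :* h)) refl b (t ^ n) h x)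

  ≃-*ʳ : ∀ {n a b} x → a ≃[ n ] b → a * x ≃[ n ] b * x
  ≃-*ʳ x e = ≃-trans (≈⇒≃ (*-comm _ x)) (≃-trans (≃-*ˡ x e) (≈⇒≃ (*-comm x _)))

  ≃-* : ∀ {n a b c d} → a ≃[ n ] b → c ≃[ n ] d → a * c ≃[ n ] b * d
  ≃-* e f = ≃-trans (≃-*ʳ _ e) (≃-*ˡ _ f)

  ≃-weighted : ∀ {m k a b x} → x ≃[ m ] 0# → a ≃[ k ] b → x * a ≃[ m ℕ.+ k ] x * b
  ≃-weighted {m} {k} {a} {b} {x} (h by e) (l by f) = (h * l) by (begin
    x * a ≈⟨ *-congˡ f ⟩
    x * (b + t ^ k * l) ≈⟨ distribˡ x _ _ ⟩
    x * b + x * (t ^ k * l) ≈⟨ +-congˡ (*-congʳ (trans e (+-identityˡ _))) ⟩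
    x * b + t ^ m * h * (t ^ k * l) ≈⟨ +-congˡ (trans (solve 4 (λ a b c d → a :* b :* (c :* d) := a :* c :* (b :* d)) refl _ _ _ _)
      (*-congʳ (sym (^-homo-* t m k)))) ⟩
    x * b + t ^ (m ℕ.+ k) * (h * l) ∎)

  diag-≃ : ∀ {n f g} k → (∀ i j → i ℕ.+ j ≡ k → f i j ≃[ n ] g i j) → diag f k ≃[ n ] diag g k
  diag-≃ zero h = h 0 0 ≡.refl
  diag-≃ (suc k) h = ≃-+ (h 0 (suc k) ≡.refl) (diag-≃ k λ i j e → h (suc i) j (≡.cong suc e))

  ∑≤ : (ℕ → Carrier) → ℕ → Carrier
  ∑≤ g = diag (λ s _ → g s)

  power-vanishes : ∀ {q r} → q ≈ t * r → ∀ {n k} x → n ℕ.≤ k → q ^ k * x ≃[ n ] 0#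
  power-vanishes {q} {r} e {n} {k} x n≤k = (t ^ d * r ^ k * x) by (begin
    q ^ k * x ≈⟨ *-congʳ (trans (^-congˡ k e) (^-distrib t r k)) ⟩
    t ^ k * r ^ k * x ≈⟨ *-congʳ (*-congʳ (^-split t n d (ℕₚ.m+[n∸m]≡n n≤k))) ⟩
    t ^ n * t ^ d * r ^ k * x ≈⟨ solve 4 (λ a b c d → a :* b :* c :* d := :0 :+ a :* (b :* c :* d)) refl _ _ _ _ ⟩
    0# + t ^ n * (t ^ d * r ^ k * x) ∎)
    where
    d = k ℕ.∸ n

  module _ {q r : Carrier} {u : ℕ → Carrier} (q≈tr : q ≈ t * r) (rec : Reciprocal q u) where
    open Reciprocal rec

    private
      poch-stable : ∀ k d → q ⨾ q ⟨ k ℕ.+ d ⟩ ≃[ k ] q ⨾ q ⟨ k ⟩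
      poch-stable k zero = ≈⇒≃ (reflexive (≡.cong (q ⨾ q ⟨_⟩) (ℕₚ.+-identityʳ k)))
      poch-stable k (suc d) = ≃-trans
        (≈⇒≃ (trans (reflexive (≡.cong (q ⨾ q ⟨_⟩) (ℕₚ.+-suc k d)))
          (solve 2 (λ p a → p :* (:1 :- a) := p :+ a :* (:- p)) refl _ _)))
        (≃-trans (≃-+ (poch-stable k d) (power-vanishes q≈tr _ (ℕₚ.m≤n⇒m≤1+n (ℕₚ.m≤m+n k d)))) (≈⇒≃ (+-identityʳ _)))

      u-stable : ∀ k d → u (k ℕ.+ d) ≃[ k ] u k
      u-stable k zero = ≈⇒≃ (reflexive (≡.cong u (ℕₚ.+-identityʳ k)))
      u-stable k (suc d) = ≃-trans
        (≈⇒≃ (trans (reflexive (≡.cong u (ℕₚ.+-suc k d)))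
          (trans (solve 2 (λ v a → v := (:1 :- a) :* v :+ a :* v) refl _ (q ^ suc (k ℕ.+ d))) (+-congʳ (step (k ℕ.+ d))))))
        (≃-trans (≃-+ (u-stable k d) (power-vanishes q≈tr _ (ℕₚ.m≤n⇒m≤1+n (ℕₚ.m≤m+n k d)))) (≈⇒≃ (+-identityʳ _)))

    limit : ∀ {k L n} → k ℕ.≤ L → k ℕ.≤ n → q ⨾ q ⟨ L ⟩ * u n ≃[ k ] 1#
    limit {k} {L} {n} k≤L k≤n = ≃-trans (≃-*
      (≃-trans (≈⇒≃ (reflexive (≡.cong (q ⨾ q ⟨_⟩) (≡.sym (ℕₚ.m+[n∸m]≡n k≤L))))) (poch-stable k (L ℕ.∸ k)))
      (≃-trans (≈⇒≃ (reflexive (≡.cong u (≡.sym (ℕₚ.m+[n∸m]≡n k≤n))))) (u-stable k (n ℕ.∸ k))))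
      (≈⇒≃ (reciprocal rec k))

    -- The error of u k ≈ 1/(q;q)_∞ is O(q^k), and g s = O(q^s), so every term is exact to order N.
    limit-sum : ∀ (g : ℕ → Carrier) → (∀ s → g s ≃[ s ] 0#) → ∀ {L} N → N ℕ.≤ L →
      diag (λ s k → g s * u k) N * q ⨾ q ⟨ L ⟩ ≃[ N ] ∑≤ g N
    limit-sum g small {L} N N≤L = ≃-trans (≈⇒≃ (diag-* _ _ N)) (diag-≃ N term)
      where
      term : ∀ s k → s ℕ.+ k ≡ N → g s * u k * q ⨾ q ⟨ L ⟩ ≃[ N ] g s
      term s k ≡.refl = ≃-trans (≈⇒≃ (solve 3 (λ a b c → a :* b :* c := a :* (c :* b)) refl _ _ _))
        (≃-trans (≃-weighted (small s) (limit (ℕₚ.m+n≤o⇒n≤o s N≤L) ℕₚ.≤-refl)) (≈⇒≃ (*-identityʳ _)))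

    limit-sum₂ : ∀ (a : ℕ → Carrier) (c : ℕ → ℕ) → (∀ s → a s ≃[ s ] 0#) → ∀ {L} N → N ℕ.≤ L →
      diag (λ m j → a m * u j * u (c m ℕ.+ j)) N * (q ⨾ q ⟨ L ⟩ * q ⨾ q ⟨ L ⟩) ≃[ N ] ∑≤ a N
    limit-sum₂ a c small {L} N N≤L = ≃-trans (≈⇒≃ (diag-* _ _ N)) (diag-≃ N term)
      where
      term : ∀ m j → m ℕ.+ j ≡ N → a m * u j * u (c m ℕ.+ j) * (q ⨾ q ⟨ L ⟩ * q ⨾ q ⟨ L ⟩) ≃[ N ] a m
      term m j ≡.refl = ≃-trans (≈⇒≃ (solve 4 (λ a b c p → a :* b :* c :* (p :* p) := a :* (p :* b :* (p :* c))) refl _ _ _ _))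
        (≃-trans (≃-weighted (small m) (≃-* (limit (ℕₚ.m+n≤o⇒n≤o m N≤L) ℕₚ.≤-refl) (limit (ℕₚ.m+n≤o⇒n≤o m N≤L) (ℕₚ.m≤n+m j (c m)))))
          (≈⇒≃ (solve 1 (λ a → a :* (:1 :* :1) := a) refl _)))

module RogersRamanujan (R : CommutativeRing 0ℓ 0ℓ) {q : CommutativeRing.Carrier R} where
  open CommutativeRing R renaming (zero to *-zero)
  open IntegerCoefficients R
  open DiagonalSums R
  open QSeries R
  open Units R
  open Gauss R
  open Products R
  open Limits R q
  open import Algebra.Properties.Semiring.Exp semiring
  open import Relation.Binary.Reasoning.Setoid setoid

  private
    q≈q1 : q ≈ q * 1#
    q≈q1 = sym (*-identityʳ q)

    Q = q ^ 5

    pent : ∀ n → q ⨾ q ⟨ five n ⟩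
      ≈ (q ^ 1 ⨾ Q ⟨ n ⟩ * q ^ 4 ⨾ Q ⟨ n ⟩) * (q ^ 2 ⨾ Q ⟨ n ⟩ * q ^ 3 ⨾ Q ⟨ n ⟩ * Q ⨾ Q ⟨ n ⟩)
    pent zero = solve 0 (:1 := :1 :* :1 :* (:1 :* :1 :* :1)) refl
    pent (suc n) = trans
      (*-cong (*-cong (*-cong (*-cong (*-cong (pent n) (shift 0)) (shift 1)) (shift 2)) (shift 3)) (shift 4))
      (solve 10 (λ a b c d e f g h i j → a :* d :* (b :* c :* e) :* f :* g :* h :* i :* j
        := a :* f :* (d :* i) :* (b :* g :* (c :* h) :* (e :* j))) refl
        (q ^ 1 ⨾ Q ⟨ n ⟩) (q ^ 2 ⨾ Q ⟨ n ⟩) (q ^ 3 ⨾ Q ⟨ n ⟩) (q ^ 4 ⨾ Q ⟨ n ⟩) (Q ⨾ Q ⟨ n ⟩) (1# - q ^ 1 * Q ^ n) _ _ _ _)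
      where
      q^five : ∀ n → q ^ five n ≈ Q ^ n
      q^five zero = refl
      q^five (suc n) = trans (^-homo-* q 5 (five n)) (*-congˡ (q^five n))
      shift : ∀ r → 1# - q * q ^ (r ℕ.+ five n) ≈ 1# - q ^ suc r * Q ^ n
      shift r = +-congˡ (-‿cong (trans (^-homo-* q (suc r) (five n)) (*-congˡ (q^five n))))

    small : ∀ {a : ℕ → ℕ} (x : ℕ → Carrier) → (∀ s → s ℕ.≤ a s) → ∀ s → q ^ a s * x s ≃[ s ] 0#
    small x h s = power-vanishes q≈q1 (x s) (h s)

    s≤s[s+e] : ∀ e s → s ℕ.≤ s ℕ.* (s ℕ.+ e)
    s≤s[s+e] e zero = ℕ.z≤n
    s≤s[s+e] e s@(suc _) = ℕₚ.m≤m*n s (s ℕ.+ e)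

  module _ {u v : ℕ → Carrier} (rec : Reciprocal q u) (rec⁵ : Reciprocal Q v)
           (q-cancel : ∀ {a b} → q * a ≈ q * b → a ≈ b) where
    private
      core : ∀ e (α : ℕ → Carrier) x w → α 0 * u e ≈ 1# →
        (∀ n → diag (λ m j → α m * u j * u (e ℕ.+ double m ℕ.+ j)) (suc n) ≈ 0#) →
        q ^ x * q ^ w ≈ Q →
        (∀ N → ∑≤ (λ m → q ^ (m ℕ.* (m ℕ.+ e)) * (q ^ (m ℕ.* (m ℕ.+ e)) * α m)) N ≃[ N ] ∑≤ (theta Q (q ^ x) (q ^ w)) N) →
        (∀ m → theta Q (q ^ x) (q ^ w) m ≃[ m ] 0#) → ∀ N →
        ∑≤ (λ s → q ^ (s ℕ.* (s ℕ.+ e)) * u s) N * q ⨾ q ⟨ five N ⟩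
          ≃[ N ] q ^ x ⨾ Q ⟨ N ⟩ * q ^ w ⨾ Q ⟨ N ⟩ * Q ⨾ Q ⟨ N ⟩
      core e α x w α0 αsuc xw≈Q theta-sum theta-small N =
        ≃-trans (≃-*ʳ P (≃-sym (limit-sum q≈q1 rec (λ s → q ^ (s ℕ.* (s ℕ.+ e)) * u s) (small u (s≤s[s+e] e)) N (n≤five N))))
        (≃-trans (≈⇒≃ (trans (*-assoc _ P P) (*-congʳ (finite-RR rec e α α0 αsuc N))))
        (≃-trans (limit-sum₂ q≈q1 rec (λ m → q ^ (m ℕ.* (m ℕ.+ e)) * (q ^ (m ℕ.* (m ℕ.+ e)) * α m)) (λ m → e ℕ.+ double m)
           (small _ (s≤s[s+e] e)) N (n≤five N))
        (≃-trans (theta-sum N)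
        (≃-trans (≃-sym (limit-sum₂ refl rec⁵ (theta Q (q ^ x) (q ^ w)) double theta-small N ℕₚ.≤-refl))
        (≃-trans (≈⇒≃ (trans (*-congʳ (jacobi-triple rec⁵ xw≈Q (cancel-^ q-cancel x) (cancel-^ q-cancel 5) N))
          (solve 4 (λ v x w p → v :* (x :* w) :* (p :* p) := x :* w :* p :* (p :* v)) refl _ _ _ _)))
        (≃-trans (≃-*ˡ _ (limit refl rec⁵ {N} ℕₚ.≤-refl (≡.subst (N ℕ.≤_) (≡.sym (double≡+ N)) (ℕₚ.m≤m+n N N))))
        (≈⇒≃ (*-identityʳ _))))))))
        where
        P = q ⨾ q ⟨ five N ⟩

      divide : ∀ {N a b c} n → a * b ≈ q ⨾ q ⟨ n ⟩ → c * q ⨾ q ⟨ n ⟩ ≃[ N ] b → c * a ≃[ N ] 1#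
      divide {N} {a} {b} {c} n ab h = ≃-trans (≈⇒≃ (begin
        c * a ≈⟨ *-identityʳ _ ⟨
        c * a * 1# ≈⟨ *-congˡ (reciprocal rec n) ⟨
        c * a * (q ⨾ q ⟨ n ⟩ * u n) ≈⟨ solve 4 (λ c a p u → c :* a :* (p :* u) := c :* p :* (a :* u)) refl _ _ _ _ ⟩
        c * q ⨾ q ⟨ n ⟩ * (a * u n) ∎))
        (≃-trans (≃-*ʳ _ h) (≈⇒≃ (trans (solve 3 (λ a b u → b :* (a :* u) := a :* b :* u) refl a b (u n))
          (trans (*-congʳ ab) (reciprocal rec n)))))

      Q^*q^ : ∀ a b {c} → 5 ℕ.* a ℕ.+ b ≡ c → Q ^ a * q ^ b ≈ q ^ c
      Q^*q^ a b e = trans (*-congʳ (^-assocʳ q 5 a)) (^-merge q (5 ℕ.* a) b e)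

      theta-small : ∀ x w m → theta Q (q ^ suc x) (q ^ suc w) m ≃[ m ] 0#
      theta-small x w zero = 1# by solve 0 (:1 := :0 :+ :1 :* :1) refl
      theta-small x w m@(suc _) = ≃-trans (≈⇒≃ (solve 4 (λ e t x w → e :* t :* (x :+ w) := x :* (e :* t) :+ w :* (e :* t)) refl _ _ _ _))
        (≃-trans (≃-+ (power-vanishes {r = q ^ x} refl _ ℕₚ.≤-refl) (power-vanishes {r = q ^ w} refl _ ℕₚ.≤-refl)) (≈⇒≃ (+-identityˡ 0#)))

    rogers-ramanujan₀ : ∀ N → ∑≤ (λ s → q ^ (s ℕ.* (s ℕ.+ 0)) * u s) N * (q ^ 1 ⨾ Q ⟨ N ⟩ * q ^ 4 ⨾ Q ⟨ N ⟩) ≃[ N ] 1#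
    rogers-ramanujan₀ N = divide (five N) (sym (pent N))
      (core 0 (unit₀ q) 2 3 (trans (*-identityˡ _) (Reciprocal.u0 rec)) (unit₀-pair rec) (^-merge q 2 3 ≡.refl)
        (λ N → ≈⇒≃ (diag-cong N λ m _ _ → term m)) (theta-small 1 2) N)
      where
      arith₁ : ∀ m a → m ℕ.+ (a ℕ.+ a) ℕ.+ (m ℕ.+ (a ℕ.+ a) ℕ.+ a) ≡ 5 ℕ.* a ℕ.+ 2 ℕ.* m
      arith₁ = solve-∀
      arith₂ : ∀ m a → 5 ℕ.* a ℕ.+ 3 ℕ.* m ≡ 5 ℕ.* a ℕ.+ 2 ℕ.* m ℕ.+ m
      arith₂ = solve-∀
      expo : ∀ m → m ℕ.* (m ℕ.+ 0) ℕ.+ (m ℕ.* (m ℕ.+ 0) ℕ.+ tri m) ≡ 5 ℕ.* tri m ℕ.+ 2 ℕ.* m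
      expo m = ≡.trans (≡.cong (λ s → s ℕ.+ (s ℕ.+ tri m)) (≡.trans (≡.cong (m ℕ.*_) (ℕₚ.+-identityʳ m)) (≡.sym (tri-square m)))) (arith₁ m (tri m))
      term : ∀ m → q ^ (m ℕ.* (m ℕ.+ 0)) * (q ^ (m ℕ.* (m ℕ.+ 0)) * unit₀ q m) ≈ theta Q (q ^ 2) (q ^ 3) m
      term zero = solve 0 (:1 :* (:1 :* :1) := :1) refl
      term m@(suc _) = begin
        q ^ s * (q ^ s * (ε ^ m * q ^ tri m * (1# + q ^ m)))
          ≈⟨ solve 4 (λ s e t a → s :* (s :* (e :* t :* (:1 :+ a))) := e :* (s :* (s :* t) :+ s :* (s :* t) :* a)) refl _ _ _ _ ⟩
        ε ^ m * (q ^ s * (q ^ s * q ^ tri m) + q ^ s * (q ^ s * q ^ tri m) * q ^ m)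
          ≈⟨ *-congˡ (+-cong base (*-congʳ base)) ⟩
        ε ^ m * (q ^ (5 ℕ.* tri m ℕ.+ 2 ℕ.* m) + q ^ (5 ℕ.* tri m ℕ.+ 2 ℕ.* m) * q ^ m)
          ≈⟨ *-congˡ (+-cong (Q^*q^ (tri m) (2 ℕ.* m) ≡.refl)
               (trans (Q^*q^ (tri m) (3 ℕ.* m) (arith₂ m (tri m))) (^-homo-* q (5 ℕ.* tri m ℕ.+ 2 ℕ.* m) m))) ⟨
        ε ^ m * (Q ^ tri m * q ^ (2 ℕ.* m) + Q ^ tri m * q ^ (3 ℕ.* m))
          ≈⟨ *-congˡ (+-cong (*-congˡ (^-assocʳ q 2 m)) (*-congˡ (^-assocʳ q 3 m))) ⟨
        ε ^ m * (Q ^ tri m * (q ^ 2) ^ m + Q ^ tri m * (q ^ 3) ^ m)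
          ≈⟨ solve 4 (λ e t x w → e :* (t :* x :+ t :* w) := e :* t :* (x :+ w)) refl _ _ _ _ ⟩
        theta Q (q ^ 2) (q ^ 3) m ∎
        where
        s = m ℕ.* (m ℕ.+ 0)
        base : q ^ s * (q ^ s * q ^ tri m) ≈ q ^ (5 ℕ.* tri m ℕ.+ 2 ℕ.* m)
        base = trans (*-congˡ (sym (^-homo-* q s (tri m)))) (^-merge q s (s ℕ.+ tri m) (expo m))

    rogers-ramanujan₁ : ∀ N → ∑≤ (λ s → q ^ (s ℕ.* (s ℕ.+ 1)) * u s) N * (q ^ 2 ⨾ Q ⟨ N ⟩ * q ^ 3 ⨾ Q ⟨ N ⟩) ≃[ N ] 1#
    rogers-ramanujan₁ N = divide (five N) (trans
        (solve 5 (λ a b c d e → b :* c :* (a :* d :* e) := a :* d :* (b :* c :* e)) refl _ _ _ _ _) (sym (pent N)))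
      (core 1 (unit₁ q) 1 4 unit₁0 (unit₁-pair rec) (^-merge q 1 4 ≡.refl)
        (λ N → ≃-trans (≈⇒≃ (telescope N)) (≃-trans (≃-+ (≈⇒≃ refl) (c-small N)) (≈⇒≃ (+-identityʳ _)))) (theta-small 0 3) N)
      where
      unit₁0 : unit₁ q 0 * u 1 ≈ 1#
      unit₁0 = trans (*-congʳ (trans (*-congʳ (*-identityˡ 1#)) (*-identityˡ _))) (trans (Reciprocal.step rec 0) (Reciprocal.u0 rec))
      b c : ℕ → Carrier
      b m = ε ^ m * Q ^ tri m * (q ^ 4) ^ m
      c m = ε ^ m * Q ^ tri m * (q ^ 1) ^ m
      c-small : ∀ N → c (suc N) ≃[ N ] 0#
      c-small N = ≃-trans (≈⇒≃ (*-comm _ _)) (power-vanishes {r = 1#} refl _ (ℕₚ.n≤1+n N))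
      arith₁ : ∀ m a → m ℕ.+ (a ℕ.+ a) ℕ.+ m ℕ.+ (m ℕ.+ (a ℕ.+ a) ℕ.+ m ℕ.+ a) ≡ 5 ℕ.* a ℕ.+ 4 ℕ.* m
      arith₁ = solve-∀
      arith₂ : ∀ m a → 5 ℕ.* (m ℕ.+ a) ℕ.+ 1 ℕ.* suc m ≡ 5 ℕ.* a ℕ.+ 4 ℕ.* m ℕ.+ suc (m ℕ.+ m)
      arith₂ = solve-∀
      expo : ∀ m → m ℕ.* (m ℕ.+ 1) ℕ.+ (m ℕ.* (m ℕ.+ 1) ℕ.+ tri m) ≡ 5 ℕ.* tri m ℕ.+ 4 ℕ.* m
      expo m = ≡.trans (≡.cong (λ s → s ℕ.+ (s ℕ.+ tri m)) (≡.trans (ℕₚ.*-distribˡ-+ m m 1)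
        (≡.cong₂ ℕ._+_ (≡.sym (tri-square m)) (ℕₚ.*-identityʳ m)))) (arith₁ m (tri m))
      α : ℕ → Carrier
      α m = q ^ (m ℕ.* (m ℕ.+ 1)) * (q ^ (m ℕ.* (m ℕ.+ 1)) * unit₁ q m)
      term : ∀ m → α m ≈ b m + c (suc m)
      term m = begin
        q ^ s * (q ^ s * (ε ^ m * q ^ tri m * (1# - q ^ suc (double m))))
          ≈⟨ solve 4 (λ s e t a → s :* (s :* (e :* t :* (:1 :- a))) := e :* (s :* (s :* t)) :+ :- :1 :* e :* (s :* (s :* t) :* a)) refl _ _ _ _ ⟩
        ε ^ m * (q ^ s * (q ^ s * q ^ tri m)) + ε ^ suc m * (q ^ s * (q ^ s * q ^ tri m) * q ^ suc (double m))
          ≈⟨ +-cong (*-congˡ base) (*-congˡ (*-cong base (^-congʳ q (≡.cong suc (double≡+ m))))) ⟩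
        ε ^ m * q ^ (5 ℕ.* tri m ℕ.+ 4 ℕ.* m) + ε ^ suc m * (q ^ (5 ℕ.* tri m ℕ.+ 4 ℕ.* m) * q ^ suc (m ℕ.+ m))
          ≈⟨ +-cong (*-congˡ (Q^*q^ (tri m) (4 ℕ.* m) ≡.refl)) (*-congˡ (trans (Q^*q^ (tri (suc m)) (1 ℕ.* suc m) (arith₂ m (tri m)))
               (^-homo-* q (5 ℕ.* tri m ℕ.+ 4 ℕ.* m) (suc (m ℕ.+ m))))) ⟨
        ε ^ m * (Q ^ tri m * q ^ (4 ℕ.* m)) + ε ^ suc m * (Q ^ tri (suc m) * q ^ (1 ℕ.* suc m))
          ≈⟨ +-cong (trans (*-assoc _ _ _) (*-congˡ (*-congˡ (^-assocʳ q 4 m))))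
                    (trans (*-assoc _ _ _) (*-congˡ (*-congˡ (^-assocʳ q 1 (suc m))))) ⟨
        b m + c (suc m) ∎
        where
        s = m ℕ.* (m ℕ.+ 1)
        base : q ^ s * (q ^ s * q ^ tri m) ≈ q ^ (5 ℕ.* tri m ℕ.+ 4 ℕ.* m)
        base = trans (*-congˡ (sym (^-homo-* q s (tri m)))) (^-merge q s (s ℕ.+ tri m) (expo m))
      θ : ℕ → Carrier
      θ = theta Q (q ^ 1) (q ^ 4)
      telescope : ∀ N → ∑≤ α N ≈ ∑≤ θ N + c (suc N)
      telescope zero = trans (term 0) (+-congʳ (solve 0 (:1 :* :1 :* :1 := :1) refl))
      telescope (suc N) = begin
        ∑≤ α (suc N) ≈⟨ diag-last (λ s _ → α s) N ⟩
        ∑≤ α N + α (suc N) ≈⟨ +-cong (telescope N) (term (suc N)) ⟩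
        ∑≤ θ N + c (suc N) + (b (suc N) + c (suc (suc N)))
          ≈⟨ solve 6 (λ s e t x w z → s :+ e :* t :* x :+ (e :* t :* w :+ z) := s :+ e :* t :* (x :+ w) :+ z) refl
               (∑≤ θ N) (ε ^ suc N) (Q ^ tri (suc N)) ((q ^ 1) ^ suc N) ((q ^ 4) ^ suc N) (c (suc (suc N))) ⟩
        ∑≤ θ N + θ (suc N) + c (suc (suc N)) ≈⟨ +-congʳ (diag-last (λ s _ → θ s) N) ⟨
        ∑≤ θ (suc N) + c (suc (suc N)) ∎

    module _ {v₂ v₄ : ℕ → Carrier} (rec² : Reciprocal (q * q) v₂) (rec⁴ : Reciprocal (q * q * (q * q)) v₄) where
      private
        divided : ∀ e (a : ℕ → ℕ) → (∀ s → s ℕ.≤ a s) → ∀ N →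
          (- (q * q)) ⨾ (q * q) ⟨ N ⟩ * diag (λ n d → q ^ a n * v₄ n * v₂ d) N ≈ diag (λ s l → q ^ (s ℕ.* (s ℕ.+ e)) * u s * v₂ l) N →
          ∑≤ (λ n → q ^ a n * v₄ n) N * (- (q * q)) ⨾ (q * q) ⟨ N ⟩ ≃[ N ] ∑≤ (λ s → q ^ (s ℕ.* (s ℕ.+ e)) * u s) N
        divided e a s≤a N h = ≃-trans (≃-*ʳ M (≃-sym (limit-sum refl rec² (λ n → q ^ a n * v₄ n) (small v₄ s≤a) N ℕₚ.≤-refl)))
          (≃-trans (≈⇒≃ (trans (solve 3 (λ a b c → a :* b :* c := c :* a :* b) refl _ _ M) (*-congʳ h)))
          (limit-sum refl rec² _ (small u (s≤s[s+e] e)) N ℕₚ.≤-refl))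
          where M = (- (q * q)) ⨾ (q * q) ⟨ N ⟩

      slater₀ : ∀ N → ∑≤ (λ n → q ^ (n ℕ.* n) * v₄ n) N
        * ((- (q * q)) ⨾ (q * q) ⟨ N ⟩ * (q ^ 1 ⨾ Q ⟨ N ⟩ * q ^ 4 ⨾ Q ⟨ N ⟩)) ≃[ N ] 1#
      slater₀ N = ≃-trans (≈⇒≃ (sym (*-assoc _ _ _))) (≃-trans (≃-*ʳ _
        (divided 0 (λ n → n ℕ.* n) (λ s → ≡.subst (λ k → s ℕ.≤ s ℕ.* k) (ℕₚ.+-identityʳ s) (s≤s[s+e] 0 s)) N (reduce₀ rec rec² rec⁴ N)))
        (rogers-ramanujan₀ N))

      slater₁ : ∀ N → ∑≤ (λ n → q ^ (n ℕ.* (n ℕ.+ 2)) * v₄ n) N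
        * ((- (q * q)) ⨾ (q * q) ⟨ N ⟩ * (q ^ 2 ⨾ Q ⟨ N ⟩ * q ^ 3 ⨾ Q ⟨ N ⟩)) ≃[ N ] 1#
      slater₁ N = ≃-trans (≈⇒≃ (sym (*-assoc _ _ _))) (≃-trans (≃-*ʳ _
        (divided 1 (λ n → n ℕ.* (n ℕ.+ 2)) (s≤s[s+e] 2) N (reduce₁ rec rec² rec⁴ N)))
        (rogers-ramanujan₁ N))

binom2-even : ∀ m → binom2 (+ double (suc m)) ≡ suc m ℕ.* suc (double m)
binom2-even m = ≡.trans (≡.cong (ℕ._/ 2) (≡.trans (≡.cong (λ d → suc (suc d) ℕ.* suc d) (double≡+ m)) (arith m)))
  (≡.trans (m*n/n≡m _ 2) (≡.cong (λ d → suc m ℕ.* suc d) (≡.sym (double≡+ m))))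
  where
  arith : ∀ m → suc (suc (m ℕ.+ m)) ℕ.* suc (m ℕ.+ m) ≡ suc m ℕ.* suc (m ℕ.+ m) ℕ.* 2
  arith = solve-∀

binom2-neg-even : ∀ m → binom2 (ℤ.- (+ double m)) ≡ m ℕ.* suc (double m)
binom2-neg-even zero = ≡.refl
binom2-neg-even (suc m) = ≡.trans (≡.cong (ℕ._/ 2) (≡.trans (≡.cong (λ d → suc (suc d) ℕ.* suc (suc (suc d))) (double≡+ m)) (arith m)))
  (≡.trans (m*n/n≡m _ 2) (≡.cong (λ d → suc m ℕ.* suc (suc (suc d))) (≡.sym (double≡+ m))))
  where
  arith : ∀ m → suc (suc (m ℕ.+ m)) ℕ.* suc (suc (suc (m ℕ.+ m))) ≡ suc m ℕ.* suc (suc (suc (m ℕ.+ m))) ℕ.* 2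
  arith = solve-∀

binom2-odd : ∀ m → binom2 (+ suc (double m)) ≡ m ℕ.* suc (double m)
binom2-odd m = ≡.trans (≡.cong (ℕ._/ 2) (≡.trans (≡.cong (λ d → suc d ℕ.* d) (double≡+ m)) (arith m)))
  (≡.trans (m*n/n≡m _ 2) (≡.cong (λ d → m ℕ.* suc d) (≡.sym (double≡+ m))))
  where
  arith : ∀ m → suc (m ℕ.+ m) ℕ.* (m ℕ.+ m) ≡ m ℕ.* suc (m ℕ.+ m) ℕ.* 2
  arith = solve-∀

binom2-neg-odd : ∀ m → binom2 (ℤ.- (+ suc (double m))) ≡ suc m ℕ.* suc (double m)
binom2-neg-odd m = ≡.trans (≡.cong (ℕ._/ 2) (≡.trans (≡.cong (λ d → suc d ℕ.* suc (suc d)) (double≡+ m)) (arith m)))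
  (≡.trans (m*n/n≡m _ 2) (≡.cong (λ d → suc m ℕ.* suc d) (≡.sym (double≡+ m))))
  where
  arith : ∀ m → suc (m ℕ.+ m) ℕ.* suc (suc (m ℕ.+ m)) ≡ suc m ℕ.* suc (m ℕ.+ m) ℕ.* 2
  arith = solve-∀

+[d+j]-+j : ∀ d j → + (d ℕ.+ j) ℤ.- + j ≡ + d
+[d+j]-+j d j = ≡.trans (≡.cong (ℤ._- + j) (ℤₚ.pos-+ d j)) (arith (+ d) (+ j))
  where
  arith : ∀ a b → a ℤ.+ b ℤ.- b ≡ a
  arith = solve-∀ᶻ

+j-+[d+j] : ∀ d j → + j ℤ.- + (d ℕ.+ j) ≡ ℤ.- + d
+j-+[d+j] d j = ≡.trans (≡.cong (λ k → + j ℤ.- k) (ℤₚ.pos-+ d j)) (arith (+ d) (+ j))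
  where
  arith : ∀ a b → b ℤ.- (a ℤ.+ b) ≡ ℤ.- a
  arith = solve-∀ᶻ

E₁ E₂ E₃ E₄ : ℕ → ℕ → ℕ
E₁ n m = 3 ℕ.* m ℕ.* m ℕ.+ 2 ℕ.* m ℕ.* n ℕ.+ 3 ℕ.* n ℕ.* n
E₂ n m = 3 ℕ.* m ℕ.* m ℕ.+ 2 ℕ.* m ℕ.* n ℕ.+ 3 ℕ.* n ℕ.* n ℕ.+ 4 ℕ.* m ℕ.+ 4 ℕ.* n
E₃ n m = m ℕ.* m ℕ.+ 2 ℕ.* m ℕ.* n ℕ.+ n ℕ.* n
E₄ n m = m ℕ.* m ℕ.+ 2 ℕ.* m ℕ.* n ℕ.+ n ℕ.* n ℕ.+ 4 ℕ.* m ℕ.+ 4 ℕ.* n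

module Assembly (R : CommutativeRing 0ℓ 0ℓ) where
  open CommutativeRing R renaming (zero to *-zero)
  open IntegerCoefficients R
  open DiagonalSums R
  open QSeries R
  open Gauss R
  open import Algebra.Properties.Semiring.Exp semiring
  open import Relation.Binary.Reasoning.Setoid setoid

  private
    ε^[a[1+2k]] : ∀ a k → ε ^ (a ℕ.* suc (double k)) ≈ ε ^ a
    ε^[a[1+2k]] a k = begin
      ε ^ (a ℕ.* suc (double k)) ≈⟨ ^-congʳ ε (≡.trans (≡.cong (λ d → a ℕ.* suc d) (double≡+ k))
          (≡.trans (arith a k) (≡.cong (a ℕ.+_) (≡.sym (double≡+ (a ℕ.* k)))))) ⟩
      ε ^ (a ℕ.+ double (a ℕ.* k)) ≈⟨ ^-homo-* ε a _ ⟩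
      ε ^ a * ε ^ double (a ℕ.* k) ≈⟨ trans (*-congˡ (ε^double (a ℕ.* k))) (*-identityʳ _) ⟩
      ε ^ a ∎
      where
      arith : ∀ a k → a ℕ.* suc (k ℕ.+ k) ≡ a ℕ.+ (a ℕ.* k ℕ.+ a ℕ.* k)
      arith = solve-∀

  sign : ℕ → ℕ → Carrier
  sign n m = ε ^ binom2 (+ n ℤ.- + m)

  sign-diagonal : ∀ j → sign j j ≈ 1#
  sign-diagonal j = ^-congʳ ε {y = 0} (≡.cong binom2 (+[d+j]-+j 0 j))

  sign-even : ∀ m j → sign (double (suc m) ℕ.+ j) j ≈ ε ^ suc m
  sign-even m j = trans (^-congʳ ε (≡.trans (≡.cong binom2 (+[d+j]-+j (double (suc m)) j)) (binom2-even m))) (ε^[a[1+2k]] (suc m) m)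

  sign-even′ : ∀ m j → sign j (double m ℕ.+ j) ≈ ε ^ m
  sign-even′ m j = trans (^-congʳ ε (≡.trans (≡.cong binom2 (+j-+[d+j] (double m) j)) (binom2-neg-even m))) (ε^[a[1+2k]] m m)

  sign-odd : ∀ m j → sign (suc (double m ℕ.+ j)) j ≈ ε ^ m
  sign-odd m j = trans (^-congʳ ε (≡.trans (≡.cong binom2 (+[d+j]-+j (suc (double m)) j)) (binom2-odd m))) (ε^[a[1+2k]] m m)

  sign-odd′ : ∀ m j → sign j (suc (double m ℕ.+ j)) ≈ ε ^ suc m
  sign-odd′ m j = trans (^-congʳ ε (≡.trans (≡.cong binom2 (+j-+[d+j] (suc (double m)) j)) (binom2-neg-odd m))) (ε^[a[1+2k]] (suc m) m)

  reciprocal-cong : ∀ {q q′ u} → q ≈ q′ → Reciprocal q u → Reciprocal q′ u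
  reciprocal-cong e rec = record
    { u0 = Reciprocal.u0 rec
    ; step = λ n → trans (*-congʳ (+-congˡ (-‿cong (^-congˡ (suc n) (sym e))))) (Reciprocal.step rec n) }

  ⨾-cong : ∀ {x x′ q q′} → x ≈ x′ → q ≈ q′ → ∀ n → x ⨾ q ⟨ n ⟩ ≈ x′ ⨾ q′ ⟨ n ⟩
  ⨾-cong ex eq zero = refl
  ⨾-cong ex eq (suc n) = *-cong (⨾-cong ex eq n) (+-congˡ (-‿cong (*-cong ex (^-congˡ n eq))))

  ∑≤-pairs : ∀ (h c : ℕ → Carrier) → (∀ s → h (double s) ≈ c s) → (∀ s → h (suc (double s)) ≈ 0#) →
    ∀ n → diag (λ k _ → h k) (suc (double n)) ≈ diag (λ s _ → c s) n
  ∑≤-pairs h c even odd zero = trans (+-cong (even 0) (odd 0)) (+-identityʳ _)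
  ∑≤-pairs h c even odd (suc n) = +-cong (even 0) (trans (+-cong (odd 0)
    (∑≤-pairs (λ k → h (suc (suc k))) (λ s → c (suc s)) (λ s → even (suc s)) (λ s → odd (suc s)) n)) (+-identityˡ _))

  module Identities (t : Carrier) (t-cancel : ∀ {a b} → t * a ≈ t * b → a ≈ b)
    {u₄ u₈ u₁₆ u₂₀ u₄₀ : ℕ → Carrier}
    (rec₄ : Reciprocal (t ^ 4) u₄) (rec₈ : Reciprocal (t ^ 8) u₈) (rec₁₆ : Reciprocal (t ^ 16) u₁₆)
    (rec₂₀ : Reciprocal (t ^ 20) u₂₀) (rec₄₀ : Reciprocal (t ^ 40) u₄₀) where

    open Products R using (cancel-^)

    private
      powers : ∀ a b → (t ^ a) ^ b ≈ t ^ (a ℕ.* b)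
      powers = ^-assocʳ t

      t⁸ : t ^ 8 ≈ t ^ 4 * t ^ 4
      t⁸ = ^-homo-* t 4 4

      t¹⁶ : t ^ 16 ≈ t ^ 8 * t ^ 8
      t¹⁶ = ^-homo-* t 8 8

    signed : (E : ℕ → ℕ → ℕ) → ℕ → ℕ → Carrier
    signed E n m = sign n m * t ^ E n m * u₄ m * u₄ n

    module _ (E : ℕ → ℕ → ℕ) (E-sym : ∀ n m → E n m ≡ E m n) where

      -- (−1)^binom(d,2) changes sign under d ↦ −d for odd d.
      signed-odd : ∀ s → diag (signed E) (suc (double s)) ≈ 0#
      signed-odd s = trans (diag-double+1 (signed E) s) (diag-zero s λ m j _ → begin
        signed E (suc (double m ℕ.+ j)) j + signed E j (suc (double m ℕ.+ j))
          ≈⟨ +-cong (*-congʳ (*-congʳ (*-congʳ (sign-odd m j))))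
               (*-congʳ (*-congʳ (*-cong (sign-odd′ m j) (^-congʳ t (E-sym j (suc (double m ℕ.+ j))))))) ⟩
        ε ^ m * t ^ E (suc (double m ℕ.+ j)) j * u₄ j * u₄ (suc (double m ℕ.+ j))
          + ε ^ suc m * t ^ E (suc (double m ℕ.+ j)) j * u₄ (suc (double m ℕ.+ j)) * u₄ j
          ≈⟨ solve 4 (λ e t u v → e :* t :* u :* v :+ :- :1 :* e :* t :* v :* u := :0) refl _ _ _ _ ⟩
        0# ∎)

      signed-even : ∀ (A : ℕ → ℕ) → (∀ m j → E (double m ℕ.+ j) j ≡ 8 ℕ.* A (m ℕ.+ j) ℕ.+ 4 ℕ.* (m ℕ.* (m ℕ.+ 0))) →
        ∀ s → diag (signed E) (double s) ≈ (t ^ 8) ^ A s * u₈ s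
      signed-even A hE s = begin
        diag (signed E) (double s) ≈⟨ diag-double (signed E) s ⟩
        diag (fold (signed E)) s ≈⟨ diag-cong s (term s) ⟩
        diag (λ m j → (t ^ 8) ^ A s * ((t ^ 4) ^ (m ℕ.* (m ℕ.+ 0)) * fold-sign m * u₄ j * u₄ (double m ℕ.+ j))) s ≈⟨ *-diag _ _ s ⟨
        (t ^ 8) ^ A s * diag (λ m j → (t ^ 4) ^ (m ℕ.* (m ℕ.+ 0)) * fold-sign m * u₄ j * u₄ (double m ℕ.+ j)) s
          ≈⟨ *-congˡ (gauss-bailey-pair rec₄ (reciprocal-cong t⁸ rec₈) s) ⟩
        (t ^ 8) ^ A s * u₈ s ∎
        where
        t^E : ∀ m j → t ^ E (double m ℕ.+ j) j ≈ (t ^ 8) ^ A (m ℕ.+ j) * (t ^ 4) ^ (m ℕ.* (m ℕ.+ 0))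
        t^E m j = trans (^-split t (8 ℕ.* A (m ℕ.+ j)) (4 ℕ.* (m ℕ.* (m ℕ.+ 0))) (≡.sym (hE m j)))
          (sym (*-cong (powers 8 (A (m ℕ.+ j))) (powers 4 (m ℕ.* (m ℕ.+ 0)))))
        term : ∀ s m j → m ℕ.+ j ≡ s → fold (signed E) m j
          ≈ (t ^ 8) ^ A s * ((t ^ 4) ^ (m ℕ.* (m ℕ.+ 0)) * fold-sign m * u₄ j * u₄ (double m ℕ.+ j))
        term s zero j ≡.refl = trans (*-congʳ (*-congʳ (*-cong (sign-diagonal j) (t^E 0 j))))
          (solve 3 (λ a b u → :1 :* (a :* b) :* u :* u := a :* (b :* :1 :* u :* u)) refl _ _ _)
        term s m@(suc k) j ≡.refl = trans (+-cong
            (*-congʳ (*-congʳ (*-cong (sign-even k j) (t^E m j))))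
            (*-congʳ (*-congʳ (*-cong (sign-even′ m j) (trans (^-congʳ t (E-sym j (double m ℕ.+ j))) (t^E m j))))))
          (solve 5 (λ e a b u v → e :* (a :* b) :* u :* v :+ e :* (a :* b) :* v :* u := a :* (b :* (e :+ e) :* u :* v))
            refl (ε ^ m) ((t ^ 8) ^ A (m ℕ.+ j)) ((t ^ 4) ^ (m ℕ.* (m ℕ.+ 0))) (u₄ j) (u₄ (double m ℕ.+ j)))

    alternating : (E : ℕ → ℕ → ℕ) → ℕ → ℕ → Carrier
    alternating E n m = ε ^ m * t ^ E n m * u₈ m * u₈ n

    module _ (E : ℕ → ℕ → ℕ) (B : ℕ → ℕ) (hE : ∀ n m → E n m ≡ B (n ℕ.+ m)) where
      private
        diag-alternating : ∀ k → diag (alternating E) k ≈ t ^ B k * diag (λ i j → ε ^ i * u₈ i * u₈ j) k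
        diag-alternating k = begin
          diag (alternating E) k ≈⟨ diag-cong k (λ n m e → trans (*-congʳ (*-congʳ (*-congˡ (^-congʳ t (≡.trans (hE n m) (≡.cong B e))))))
             (solve 4 (λ e t u v → e :* t :* u :* v := t :* (e :* u :* v)) refl _ _ _ _)) ⟩
          diag (λ n m → t ^ B k * (ε ^ m * u₈ m * u₈ n)) k ≈⟨ *-diag _ _ k ⟨
          t ^ B k * diag (λ n m → ε ^ m * u₈ m * u₈ n) k ≈⟨ *-congˡ (diag-swap _ k) ⟩
          t ^ B k * diag (λ i j → ε ^ i * u₈ i * u₈ j) k ∎

      alternating-odd : ∀ s → diag (alternating E) (suc (double s)) ≈ 0#
      alternating-odd s = trans (diag-alternating (suc (double s))) (trans (*-congˡ (gauss-odd rec₈ s)) (zeroʳ _))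

      alternating-even : ∀ (A : ℕ → ℕ) → (∀ s → B (double s) ≡ 4 ℕ.* A s) → ∀ s → diag (alternating E) (double s) ≈ (t ^ 4) ^ A s * u₁₆ s
      alternating-even A hB s = trans (diag-alternating (double s))
        (*-cong (trans (^-congʳ t (hB s)) (sym (powers 4 (A s)))) (gauss-even rec₈ (reciprocal-cong t¹⁶ rec₁₆) s))

    private
      module RR₈ = RogersRamanujan R {t ^ 8}
      module RR₄ = RogersRamanujan R {t ^ 4}
      module L₈ = Limits R (t ^ 8)
      module L₄ = Limits R (t ^ 4)
      rec₄₀′ = reciprocal-cong (sym (powers 8 5)) rec₄₀
      rec₂₀′ = reciprocal-cong (sym (powers 4 5)) rec₂₀
      rec₈′ = reciprocal-cong t⁸ rec₈
      rec₁₆′ = reciprocal-cong (trans t¹⁶ (*-cong t⁸ t⁸)) rec₁₆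

    signed-sum : (E : ℕ → ℕ → ℕ) → ℕ → Carrier
    signed-sum E N = diag (λ k _ → diag (signed E) k) (suc (double N))

    alternating-sum : (E : ℕ → ℕ → ℕ) → ℕ → Carrier
    alternating-sum E N = diag (λ k _ → diag (alternating E) k) (suc (double N))

    identity₁ : ∀ N → signed-sum E₁ N * (t ^ 8 ⨾ t ^ 40 ⟨ N ⟩ * t ^ 32 ⨾ t ^ 40 ⟨ N ⟩) L₈.≃[ N ] 1#
    identity₁ N = L₈.≃-trans (L₈.≈⇒≃ (*-cong
        (∑≤-pairs (diag (signed E₁)) _ (signed-even E₁ E-sym A hE) (signed-odd E₁ E-sym) N)
        (sym (*-cong (⨾-cong (powers 8 1) (powers 8 5) N) (⨾-cong (powers 8 4) (powers 8 5) N)))))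
      (RR₈.rogers-ramanujan₀ rec₈ rec₄₀′ (cancel-^ t-cancel 8) N)
      where
      A : ℕ → ℕ
      A s = s ℕ.* (s ℕ.+ 0)
      E-sym : ∀ n m → 3 ℕ.* m ℕ.* m ℕ.+ 2 ℕ.* m ℕ.* n ℕ.+ 3 ℕ.* n ℕ.* n
        ≡ 3 ℕ.* n ℕ.* n ℕ.+ 2 ℕ.* n ℕ.* m ℕ.+ 3 ℕ.* m ℕ.* m
      E-sym = solve-∀
      arith : ∀ m j → 3 ℕ.* j ℕ.* j ℕ.+ 2 ℕ.* j ℕ.* (m ℕ.+ m ℕ.+ j) ℕ.+ 3 ℕ.* (m ℕ.+ m ℕ.+ j) ℕ.* (m ℕ.+ m ℕ.+ j)
        ≡ 8 ℕ.* ((m ℕ.+ j) ℕ.* (m ℕ.+ j ℕ.+ 0)) ℕ.+ 4 ℕ.* (m ℕ.* (m ℕ.+ 0))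
      arith = solve-∀
      hE : ∀ m j → E₁ (double m ℕ.+ j) j ≡ 8 ℕ.* A (m ℕ.+ j) ℕ.+ 4 ℕ.* (m ℕ.* (m ℕ.+ 0))
      hE m j = ≡.trans (≡.cong (λ d → E₁ (d ℕ.+ j) j) (double≡+ m)) (arith m j)

    identity₂ : ∀ N → signed-sum E₂ N * (t ^ 16 ⨾ t ^ 40 ⟨ N ⟩ * t ^ 24 ⨾ t ^ 40 ⟨ N ⟩) L₈.≃[ N ] 1#
    identity₂ N = L₈.≃-trans (L₈.≈⇒≃ (*-cong
        (∑≤-pairs (diag (signed E₂)) _ (signed-even E₂ E-sym A hE) (signed-odd E₂ E-sym) N)
        (sym (*-cong (⨾-cong (powers 8 2) (powers 8 5) N) (⨾-cong (powers 8 3) (powers 8 5) N)))))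
      (RR₈.rogers-ramanujan₁ rec₈ rec₄₀′ (cancel-^ t-cancel 8) N)
      where
      A : ℕ → ℕ
      A s = s ℕ.* (s ℕ.+ 1)
      E-sym : ∀ n m → 3 ℕ.* m ℕ.* m ℕ.+ 2 ℕ.* m ℕ.* n ℕ.+ 3 ℕ.* n ℕ.* n ℕ.+ 4 ℕ.* m ℕ.+ 4 ℕ.* n
        ≡ 3 ℕ.* n ℕ.* n ℕ.+ 2 ℕ.* n ℕ.* m ℕ.+ 3 ℕ.* m ℕ.* m ℕ.+ 4 ℕ.* n ℕ.+ 4 ℕ.* m
      E-sym = solve-∀
      arith : ∀ m j → 3 ℕ.* j ℕ.* j ℕ.+ 2 ℕ.* j ℕ.* (m ℕ.+ m ℕ.+ j) ℕ.+ 3 ℕ.* (m ℕ.+ m ℕ.+ j) ℕ.* (m ℕ.+ m ℕ.+ j) ℕ.+ 4 ℕ.* j ℕ.+ 4 ℕ.* (m ℕ.+ m ℕ.+ j)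
        ≡ 8 ℕ.* ((m ℕ.+ j) ℕ.* (m ℕ.+ j ℕ.+ 1)) ℕ.+ 4 ℕ.* (m ℕ.* (m ℕ.+ 0))
      arith = solve-∀
      hE : ∀ m j → E₂ (double m ℕ.+ j) j ≡ 8 ℕ.* A (m ℕ.+ j) ℕ.+ 4 ℕ.* (m ℕ.* (m ℕ.+ 0))
      hE m j = ≡.trans (≡.cong (λ d → E₂ (d ℕ.+ j) j) (double≡+ m)) (arith m j)

    identity₃ : ∀ N → alternating-sum E₃ N
      * ((- t ^ 8) ⨾ t ^ 8 ⟨ N ⟩ * (t ^ 4 ⨾ t ^ 20 ⟨ N ⟩ * t ^ 16 ⨾ t ^ 20 ⟨ N ⟩)) L₄.≃[ N ] 1#
    identity₃ N = L₄.≃-trans (L₄.≈⇒≃ (*-cong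
        (∑≤-pairs (diag (alternating E₃)) _ (alternating-even E₃ B hE A hB) (alternating-odd E₃ B hE) N)
        (*-cong (⨾-cong (-‿cong t⁸) t⁸ N) (sym (*-cong (⨾-cong (powers 4 1) (powers 4 5) N) (⨾-cong (powers 4 4) (powers 4 5) N))))))
      (RR₄.slater₀ rec₄ rec₂₀′ (cancel-^ t-cancel 4) rec₈′ rec₁₆′ N)
      where
      A B : ℕ → ℕ
      A s = s ℕ.* s
      B k = k ℕ.* k
      hE : ∀ n m → m ℕ.* m ℕ.+ 2 ℕ.* m ℕ.* n ℕ.+ n ℕ.* n ≡ (n ℕ.+ m) ℕ.* (n ℕ.+ m)
      hE = solve-∀
      arith : ∀ s → (s ℕ.+ s) ℕ.* (s ℕ.+ s) ≡ 4 ℕ.* (s ℕ.* s)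
      arith = solve-∀
      hB : ∀ s → B (double s) ≡ 4 ℕ.* A s
      hB s = ≡.trans (≡.cong B (double≡+ s)) (arith s)

    identity₄ : ∀ N → alternating-sum E₄ N
      * ((- t ^ 8) ⨾ t ^ 8 ⟨ N ⟩ * (t ^ 8 ⨾ t ^ 20 ⟨ N ⟩ * t ^ 12 ⨾ t ^ 20 ⟨ N ⟩)) L₄.≃[ N ] 1#
    identity₄ N = L₄.≃-trans (L₄.≈⇒≃ (*-cong
        (∑≤-pairs (diag (alternating E₄)) _ (alternating-even E₄ B hE A hB) (alternating-odd E₄ B hE) N)
        (*-cong (⨾-cong (-‿cong t⁸) t⁸ N) (sym (*-cong (⨾-cong (powers 4 2) (powers 4 5) N) (⨾-cong (powers 4 3) (powers 4 5) N))))))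
      (RR₄.slater₁ rec₄ rec₂₀′ (cancel-^ t-cancel 4) rec₈′ rec₁₆′ N)
      where
      A B : ℕ → ℕ
      A s = s ℕ.* (s ℕ.+ 2)
      B k = k ℕ.* k ℕ.+ 4 ℕ.* k
      hE : ∀ n m → m ℕ.* m ℕ.+ 2 ℕ.* m ℕ.* n ℕ.+ n ℕ.* n ℕ.+ 4 ℕ.* m ℕ.+ 4 ℕ.* n ≡ (n ℕ.+ m) ℕ.* (n ℕ.+ m) ℕ.+ 4 ℕ.* (n ℕ.+ m)
      hE = solve-∀
      arith : ∀ s → (s ℕ.+ s) ℕ.* (s ℕ.+ s) ℕ.+ 4 ℕ.* (s ℕ.+ s) ≡ 4 ℕ.* (s ℕ.* (s ℕ.+ 2))
      arith = solve-∀
      hB : ∀ s → B (double s) ≡ 4 ℕ.* A s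
      hB s = ≡.trans (≡.cong B (double≡+ s)) (arith s)

module ℤDiag = DiagonalSums ℤₚ.+-*-commutativeRing
open ℤDiag using () renaming (diag to diagℤ)

sumZ-upTo : ∀ n (F : ℕ → ℕ → ℤ) → sumZ (map (λ i → F i (n ℕ.∸ i)) (upTo (suc n))) ≡ diagℤ F n
sumZ-upTo n F = go n (λ i → F i (n ℕ.∸ i)) (λ i → i) F λ _ → ≡.refl
  where
  go : ∀ n (h : ℕ → ℤ) (g : ℕ → ℕ) (F : ℕ → ℕ → ℤ) → (∀ i → h (g i) ≡ F i (n ℕ.∸ i)) →
    sumZ (map h (applyUpTo g (suc n))) ≡ diagℤ F n
  go zero h g F e = ≡.trans (ℤₚ.+-identityʳ _) (e 0)
  go (suc n) h g F e = ≡.cong₂ ℤ._+_ (e 0) (go n h (g ∘ suc) (F ∘ suc) (e ∘ suc))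

*S-diag : ∀ f g n → (f *S g) n ≡ diagℤ (λ i j → f i ℤ.* g j) n
*S-diag f g n = sumZ-upTo n (λ i j → f i ℤ.* g j)

zeroS : Series
zeroS _ = + 0

negS : Series → Series
negS f n = ℤ.- f n

*S-cong : ∀ {f f′ g g′} → f ≐ f′ → g ≐ g′ → f *S g ≐ f′ *S g′
*S-cong {f} {f′} {g} {g′} ef eg n = ≡.trans (*S-diag f g n)
  (≡.trans (ℤDiag.diag-cong n λ i j _ → ≡.cong₂ ℤ._*_ (ef i) (eg j)) (≡.sym (*S-diag f′ g′ n)))

*S-comm : ∀ f g → f *S g ≐ g *S f
*S-comm f g n = ≡.trans (*S-diag f g n) (≡.trans (ℤDiag.diag-swap _ n)
  (≡.trans (ℤDiag.diag-cong n λ i j _ → ℤₚ.*-comm (f j) (g i)) (≡.sym (*S-diag g f n))))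

*S-assoc : ∀ f g h → (f *S g) *S h ≐ f *S (g *S h)
*S-assoc f g h n = begin
  ((f *S g) *S h) n ≡⟨ *S-diag (f *S g) h n ⟩
  diagℤ (λ s k → (f *S g) s ℤ.* h k) n
    ≡⟨ ℤDiag.diag-cong n (λ s k _ → ≡.trans (≡.cong (ℤ._* h k) (*S-diag f g s)) (ℤDiag.diag-* (h k) _ s)) ⟩
  diagℤ (λ s k → diagℤ (λ i j → f i ℤ.* g j ℤ.* h k) s) n ≡⟨ ℤDiag.diag-assoc (λ i j k → f i ℤ.* g j ℤ.* h k) n ⟩
  diagℤ (λ i r → diagℤ (λ j k → f i ℤ.* g j ℤ.* h k) r) n
    ≡⟨ ℤDiag.diag-cong n (λ i r _ → ≡.trans (ℤDiag.diag-cong r λ j k _ → ℤₚ.*-assoc (f i) (g j) (h k))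
         (≡.trans (≡.sym (ℤDiag.*-diag (f i) _ r)) (≡.cong (f i ℤ.*_) (≡.sym (*S-diag g h r))))) ⟩
  diagℤ (λ i r → f i ℤ.* (g *S h) r) n ≡⟨ *S-diag f (g *S h) n ⟨
  (f *S (g *S h)) n ∎
  where open ≡.≡-Reasoning

*S-identityˡ : ∀ f → oneS *S f ≐ f
*S-identityˡ f n = ≡.trans (*S-diag oneS f n)
  (≡.trans (ℤDiag.diag-head n λ i j → ℤₚ.*-zeroˡ (f j)) (ℤₚ.*-identityˡ (f n)))

*S-distribˡ : ∀ f g h → f *S (g +S h) ≐ (f *S g) +S (f *S h)
*S-distribˡ f g h n = ≡.trans (*S-diag f (g +S h) n) (≡.trans
  (≡.trans (ℤDiag.diag-cong n λ i j _ → ℤₚ.*-distribˡ-+ (f i) (g j) (h j)) (ℤDiag.diag-+ _ _ n))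
  (≡.sym (≡.cong₂ ℤ._+_ (*S-diag f g n) (*S-diag f h n))))

infix 4 _≋_

-- A record, unlike _≐_, lets unification recover the two series from an equation.
record _≋_ (f g : Series) : Set where
  constructor by-coefficients
  field
    at : f ≐ g

open _≋_

seriesRing : CommutativeRing 0ℓ 0ℓ
seriesRing = record
  { Carrier = Series ; _≈_ = _≋_ ; _+_ = _+S_ ; _*_ = _*S_ ; -_ = negS ; 0# = zeroS ; 1# = oneS
  ; isCommutativeRing = record
    { isRing = record
      { +-isAbelianGroup = record
        { isGroup = record
          { isMonoid = record
            { isSemigroup = record
              { isMagma = record
                { isEquivalence = record
                  { refl = by-coefficients λ _ → ≡.refl
                  ; sym = λ e → by-coefficients λ n → ≡.sym (at e n)
                  ; trans = λ e e′ → by-coefficients λ n → ≡.trans (at e n) (at e′ n) }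
                ; ∙-cong = λ e e′ → by-coefficients λ n → ≡.cong₂ ℤ._+_ (at e n) (at e′ n) }
              ; assoc = λ f g h → by-coefficients λ n → ℤₚ.+-assoc (f n) (g n) (h n) }
            ; identity = (λ f → by-coefficients λ n → ℤₚ.+-identityˡ (f n)) , (λ f → by-coefficients λ n → ℤₚ.+-identityʳ (f n)) }
          ; inverse = (λ f → by-coefficients λ n → ℤₚ.+-inverseˡ (f n)) , (λ f → by-coefficients λ n → ℤₚ.+-inverseʳ (f n))
          ; ⁻¹-cong = λ e → by-coefficients λ n → ≡.cong ℤ.-_ (at e n) }
        ; comm = λ f g → by-coefficients λ n → ℤₚ.+-comm (f n) (g n) }
      ; *-cong = λ {f} {f′} {g} {g′} e e′ → by-coefficients (*S-cong {f} {f′} {g} {g′} (at e) (at e′))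
      ; *-assoc = λ f g h → by-coefficients (*S-assoc f g h)
      ; *-identity = (λ f → by-coefficients (*S-identityˡ f))
          , (λ f → by-coefficients λ n → ≡.trans (*S-comm f oneS n) (*S-identityˡ f n))
      ; distrib = (λ f g h → by-coefficients (*S-distribˡ f g h))
          , (λ f g h → by-coefficients λ n → ≡.trans (*S-comm (g +S h) f n)
              (≡.trans (*S-distribˡ f g h n) (≡.cong₂ ℤ._+_ (*S-comm f g n) (*S-comm f h n)))) }
    ; *-comm = λ f g → by-coefficients (*S-comm f g) } }

open CommutativeRing seriesRing
  using (refl; sym; trans; -‿cong; +-congˡ; *-cong; *-congˡ; *-congʳ; *-assoc; *-identityˡ; *-identityʳ; semiring; setoid)
open IntegerCoefficients seriesRing
open DiagonalSums seriesRing
open QSeries seriesRing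
open Assembly seriesRing
open import Algebra.Properties.Semiring.Exp semiring

coeff-diag : ∀ (f : ℕ → ℕ → Series) n i → diag f n i ≡ diagℤ (λ a b → f a b i) n
coeff-diag f zero i = ≡.refl
coeff-diag f (suc n) i = ≡.cong (λ x → f 0 (suc n) i ℤ.+ x) (coeff-diag (f ∘ suc) n i)

t : Series
t = mono (+ 1) 1

t*-zero : ∀ f → (t *S f) 0 ≡ + 0
t*-zero f = *S-diag t f 0

t*-suc : ∀ f n → (t *S f) (suc n) ≡ f n
t*-suc f n = ≡.trans (*S-diag t f (suc n)) (≡.trans
  (≡.cong₂ ℤ._+_ (ℤₚ.*-zeroˡ (f (suc n))) (ℤDiag.diag-head n λ i j → ℤₚ.*-zeroˡ (f j)))
  (≡.trans (ℤₚ.+-identityˡ _) (ℤₚ.*-identityˡ (f n))))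

t-cancel : ∀ {f g} → t *S f ≋ t *S g → f ≋ g
t-cancel {f} {g} e = by-coefficients λ n → ≡.trans (≡.sym (t*-suc f n)) (≡.trans (at e (suc n)) (t*-suc g n))

t^*-low : ∀ e f i → i ℕ.< e → (t ^ e *S f) i ≡ + 0
t^*-low (suc e) f zero _ = ≡.trans (*S-assoc t (t ^ e) f 0) (t*-zero (t ^ e *S f))
t^*-low (suc e) f (suc i) (ℕ.s≤s i<e) = ≡.trans (*S-assoc t (t ^ e) f (suc i)) (≡.trans (t*-suc (t ^ e *S f) i) (t^*-low e f i i<e))

mono≋t^ : ∀ e → mono (+ 1) e ≋ t ^ e
mono≋t^ e = by-coefficients (go e)
  where
  go : ∀ e → mono (+ 1) e ≐ t ^ e
  go zero zero = ≡.refl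
  go zero (suc n) = ≡.refl
  go (suc e) zero = ≡.sym (t*-zero (t ^ e))
  go (suc e) (suc n) = ≡.trans (go e n) (≡.sym (t*-suc (t ^ e) n))

mono-neg : ∀ c e → mono (ℤ.- c) e ≋ negS (mono c e)
mono-neg c e = by-coefficients go
  where
  go : mono (ℤ.- c) e ≐ negS (mono c e)
  go n with n ≡ᵇ e
  ... | true = ≡.refl
  ... | false = ≡.refl

mono-sgn : ∀ k e → mono (sgn k) e ≋ ε ^ k *S t ^ e
mono-sgn zero e = trans (mono≋t^ e) (sym (*-identityˡ (t ^ e)))
mono-sgn (suc k) e = trans (by-coefficients λ n → ≡.cong (λ c → mono c e n) (ℤₚ.-1*i≡-i (sgn k)))
  (trans (mono-neg (sgn k) e) (trans (-‿cong (mono-sgn k e))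
    (solve 2 (λ a b → :- (a :* b) := :- :1 :* a :* b) refl (ε ^ k) (t ^ e))))

t^[e+sn] : ∀ e s n → mono (+ 1) (e ℕ.+ s ℕ.* n) ≋ t ^ e *S (t ^ s) ^ n
t^[e+sn] e s n = trans (mono≋t^ (e ℕ.+ s ℕ.* n)) (trans (^-homo-* t e (s ℕ.* n))
  (*-congˡ {t ^ e} {t ^ (s ℕ.* n)} {(t ^ s) ^ n} (sym (^-assocʳ t s n))))

poch⁺ : ∀ e s n → poch (+ 1) e s n ≋ t ^ e ⨾ t ^ s ⟨ n ⟩
poch⁺ e s zero = refl
poch⁺ e s (suc n) = *-cong {poch (+ 1) e s n} {t ^ e ⨾ t ^ s ⟨ n ⟩} {oneMinus (+ 1) x} {oneS +S negS y} (poch⁺ e s n)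
  (+-congˡ {oneS} {mono (ℤ.- (+ 1)) x} {negS y} (trans (mono-neg (+ 1) x) (-‿cong {mono (+ 1) x} {y} (t^[e+sn] e s n))))
  where
  x = e ℕ.+ s ℕ.* n
  y = t ^ e *S (t ^ s) ^ n

poch⁻ : ∀ e s n → poch (ℤ.- + 1) e s n ≋ negS (t ^ e) ⨾ t ^ s ⟨ n ⟩
poch⁻ e s zero = refl
poch⁻ e s (suc n) = *-cong {poch (ℤ.- + 1) e s n} {negS (t ^ e) ⨾ t ^ s ⟨ n ⟩} {oneMinus (ℤ.- + 1) x} {oneS +S negS y} (poch⁻ e s n)
  (+-congˡ {oneS} {mono (+ 1) x} {negS y} (trans (t^[e+sn] e s n)
    (solve 2 (λ a b → a :* b := :- ((:- a) :* b)) refl (t ^ e) ((t ^ s) ^ n))))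
  where
  x = e ℕ.+ s ℕ.* n
  y = negS (t ^ e) *S (t ^ s) ^ n

invS-inverse : ∀ f → f 0 ≡ + 1 → f *S invS f ≐ oneS
invS-inverse f f0 zero = ≡.trans (*S-diag f (invS f) 0) (≡.trans (ℤₚ.*-identityʳ (f 0)) f0)
invS-inverse f f0 (suc n) = ≡.trans (*S-diag f (invS f) (suc n)) (≡.trans
  (≡.cong₂ (λ a b → a ℤ.* ℤ.- b ℤ.+ diagℤ (λ i j → f (suc i) ℤ.* invS f j) n) f0 (convolution n (f ∘ suc)))
  (arith (diagℤ (λ i j → f (suc i) ℤ.* invS f j) n)))
  where
  arith : ∀ x → + 1 ℤ.* ℤ.- x ℤ.+ x ≡ + 0
  arith = solve-∀ᶻ
  shift : ∀ (g : ℕ → ℤ) (h : ℕ → ℕ) l L → zipWith ℤ._*_ (map g (applyUpTo (suc ∘ h) l)) L ≡ zipWith ℤ._*_ (map (g ∘ suc) (applyUpTo h l)) L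
  shift g h zero L = ≡.refl
  shift g h (suc l) [] = ≡.refl
  shift g h (suc l) (x ∷ L) = ≡.cong (_ ∷_) (shift g (h ∘ suc) l L)
  convolution : ∀ n (g : ℕ → ℤ) → sumZ (zipWith ℤ._*_ (map g (upTo (length (invRev f n)))) (invRev f n)) ≡ diagℤ (λ i j → g i ℤ.* invS f j) n
  convolution zero g = ℤₚ.+-identityʳ _
  convolution (suc n) g = ≡.cong (λ x → g 0 ℤ.* invS f (suc n) ℤ.+ x)
    (≡.trans (≡.cong sumZ (shift g (λ i → i) (length (invRev f n)) (invRev f n))) (convolution n (g ∘ suc)))

*S-unital : ∀ f g → f 0 ≡ + 1 → g 0 ≡ + 1 → (f *S g) 0 ≡ + 1
*S-unital f g f0 g0 = ≡.trans (*S-diag f g 0) (≡.cong₂ ℤ._*_ f0 g0)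

poch-unital : ∀ c e s n → poch c (suc e) s n 0 ≡ + 1
poch-unital c e s zero = ≡.refl
poch-unital c e s (suc n) = *S-unital (poch c (suc e) s n) (oneMinus c (suc e ℕ.+ s ℕ.* n)) (poch-unital c e s n) ≡.refl

1/poch : ℕ → ℕ → Series
1/poch c n = invS (poch (+ 1) c c n)

1/poch-reciprocal : ∀ c → Reciprocal (t ^ suc c) (1/poch (suc c))
1/poch-reciprocal c = record
  { u0 = trans (sym (*-identityˡ (1/poch d 0))) (by-coefficients (invS-inverse oneS ≡.refl))
  ; step = λ n → begin
      b n *S u (suc n) ≈⟨ *-identityˡ (b n *S u (suc n)) ⟨
      oneS *S (b n *S u (suc n)) ≈⟨ *-congʳ (inv n) ⟨
      p n *S u n *S (b n *S u (suc n)) ≈⟨ solve 4 (λ p u b w → p :* u :* (b :* w) := p :* b :* w :* u) refl (p n) (u n) (b n) (u (suc n)) ⟩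
      p n *S b n *S u (suc n) *S u n ≈⟨ *-congʳ (trans (*-congʳ (sym (p-step n))) (inv (suc n))) ⟩
      oneS *S u n ≈⟨ *-identityˡ (u n) ⟩
      u n ∎ }
  where
  open import Relation.Binary.Reasoning.Setoid setoid
  d = suc c
  p u b : ℕ → Series
  p = poch (+ 1) d d
  u = 1/poch d
  b n = oneS +S negS ((t ^ d) ^ suc n)
  inv : ∀ n → p n *S u n ≋ oneS
  inv n = by-coefficients (invS-inverse (p n) (poch-unital (+ 1) c d n))
  p-step : ∀ n → p (suc n) ≋ p n *S b n
  p-step n = *-congˡ {p n} {oneMinus (+ 1) (d ℕ.+ d ℕ.* n)} {b n} (+-congˡ {oneS} {mono (ℤ.- (+ 1)) (d ℕ.+ d ℕ.* n)} {negS ((t ^ d) ^ suc n)}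
    (trans (mono-neg (+ 1) (d ℕ.+ d ℕ.* n)) (-‿cong (t^[e+sn] d d n))))

infix 4 _≐[_]_

_≐[_]_ : Series → ℕ → Series → Set
f ≐[ N ] g = ∀ i → i ℕ.< N → f i ≡ g i

*S-≐[] : ∀ {f f′ g g′ N} → f ≐[ N ] f′ → g ≐[ N ] g′ → f *S g ≐[ N ] f′ *S g′
*S-≐[] {f} {f′} {g} {g′} ef eg i i<N = ≡.trans (*S-diag f g i) (≡.trans
  (ℤDiag.diag-cong i λ a b e → ≡.cong₂ ℤ._*_
    (ef a (ℕₚ.≤-<-trans (≡.subst (a ℕ.≤_) e (ℕₚ.m≤m+n a b)) i<N))
    (eg b (ℕₚ.≤-<-trans (≡.subst (b ℕ.≤_) e (ℕₚ.m≤n+m b a)) i<N)))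
  (≡.sym (*S-diag f′ g′ i)))

mono-low : ∀ c e i → i ℕ.< e → mono c e i ≡ + 0
mono-low c (suc e) zero _ = ≡.refl
mono-low c (suc e) (suc i) (ℕ.s≤s i<e) = mono-low c e i i<e

poch-stable : ∀ c e s d i → poch c (suc e) (suc s) (d ℕ.+ suc i) i ≡ poch c (suc e) (suc s) (suc i) i
poch-stable c e s zero i = ≡.refl
poch-stable c e s (suc d) i = ≡.trans (*S-distribˡ p oneS (mono (ℤ.- c) x) i) (≡.trans
  (≡.cong₂ ℤ._+_ (at (*-identityʳ p) i) (≡.trans (*S-diag p (mono (ℤ.- c) x) i) (ℤDiag.diag-zero i λ a b e′ →
    ≡.trans (≡.cong (p a ℤ.*_) (mono-low (ℤ.- c) x b (ℕₚ.≤-<-trans (≡.subst (b ℕ.≤_) e′ (ℕₚ.m≤n+m b a)) i<x))) (ℤₚ.*-zeroʳ (p a)))))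
  (≡.trans (ℤₚ.+-identityʳ _) (poch-stable c e s d i)))
  where
  n = d ℕ.+ suc i
  p = poch c (suc e) (suc s) n
  x = suc e ℕ.+ suc s ℕ.* n
  i<x : i ℕ.< x
  i<x = ℕₚ.≤-trans (ℕₚ.m≤n+m (suc i) d) (ℕₚ.≤-trans (ℕₚ.m≤m+n n (s ℕ.* n)) (ℕₚ.m≤n+m (suc s ℕ.* n) (suc e)))

pochInf-≐[] : ∀ c e s N → pochInf c (suc e) (suc s) ≐[ N ] poch c (suc e) (suc s) N
pochInf-≐[] c e s N i i<N = ≡.trans (≡.sym (poch-stable c e s (N ℕ.∸ suc i) i))
  (≡.cong (λ n → poch c (suc e) (suc s) n i) (ℕₚ.m∸n+n≡m i<N))

truncate : ∀ (h : ℕ → ℤ) r d → (∀ m → r ℕ.< m → h m ≡ + 0) → diagℤ (λ m _ → h m) (d ℕ.+ r) ≡ diagℤ (λ m _ → h m) r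
truncate h r zero vanish = ≡.refl
truncate h r (suc d) vanish = ≡.trans (ℤDiag.diag-last (λ m _ → h m) (d ℕ.+ r)) (≡.trans
  (≡.cong₂ ℤ._+_ (truncate h r d vanish) (vanish (suc (d ℕ.+ r)) (ℕ.s≤s (ℕₚ.m≤n+m r d)))) (ℤₚ.+-identityʳ _))

truncate-≤ : ∀ (h : ℕ → ℤ) {r k} → r ℕ.≤ k → (∀ m → r ℕ.< m → h m ≡ + 0) → diagℤ (λ m _ → h m) k ≡ diagℤ (λ m _ → h m) r
truncate-≤ h {r} {k} r≤k vanish = ≡.trans (≡.cong (diagℤ (λ m _ → h m)) (≡.sym (ℕₚ.m∸n+n≡m r≤k))) (truncate h r (k ℕ.∸ r) vanish)

doubleSum-diagonal : ∀ T → (∀ n m i → i ℕ.< n ℕ.+ m → T n m i ≡ + 0) → ∀ {i k} → i ℕ.≤ k → doubleSum T i ≡ diag (λ s _ → diag T s) k i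
doubleSum-diagonal T vanish {i} {k} i≤k = begin
  doubleSum T i ≡⟨ sumZ-upTo i (λ n _ → sumZ (map (λ m → T n m i) (upTo (suc i)))) ⟩
  diagℤ (λ n _ → sumZ (map (λ m → T n m i) (upTo (suc i)))) i ≡⟨ ℤDiag.diag-cong i (λ n r e → ≡.trans (sumZ-upTo i (λ m _ → T n m i)) (inner n r e)) ⟩
  diagℤ (λ n r → diagℤ (λ m _ → T n m i) r) i ≡⟨ ℤDiag.diag-assoc (λ n m _ → T n m i) i ⟨
  diagℤ (λ s _ → diagℤ (λ n m → T n m i) s) i
    ≡⟨ truncate-≤ (diagℤ (λ n m → T n m i)) i≤k (λ s i<s → ℤDiag.diag-zero s λ n m e → vanish n m i (≡.subst (i ℕ.<_) (≡.sym e) i<s)) ⟨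
  diagℤ (λ s _ → diagℤ (λ n m → T n m i) s) k ≡⟨ ℤDiag.diag-cong k (λ s _ _ → coeff-diag T s i) ⟨
  diagℤ (λ s _ → diag T s i) k ≡⟨ coeff-diag (λ s _ → diag T s) k i ⟨
  diag (λ s _ → diag T s) k i ∎
  where
  open ≡.≡-Reasoning
  inner : ∀ n r → n ℕ.+ r ≡ i → diagℤ (λ m _ → T n m i) i ≡ diagℤ (λ m _ → T n m i) r
  inner n r e = truncate-≤ (λ m → T n m i) (≡.subst (r ℕ.≤_) e (ℕₚ.m≤n+m r n))
    λ m r<m → vanish n m i (≡.subst (ℕ._< n ℕ.+ m) e (ℕₚ.+-monoʳ-< n r<m))

≃⇒≐[] : ∀ c {f g N} → Limits._≃[_]_ seriesRing (t ^ suc c) f N g → f ≐[ N ] g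
≃⇒≐[] c {f} {g} {N} (h Limits.by e) i i<N = ≡.trans (at e i) (≡.trans (≡.cong (λ x → g i ℤ.+ x)
  (≡.trans (at (*-congʳ {h} {(t ^ suc c) ^ N} {t ^ (suc c ℕ.* N)} (^-assocʳ t (suc c) N)) i) (t^*-low (suc c ℕ.* N) h i (ℕₚ.<-≤-trans i<N (ℕₚ.m≤m+n N (c ℕ.* N))))))
  (ℤₚ.+-identityʳ (g i)))

inverse-from-limits : ∀ T P (p : ℕ → Series) → P 0 ≡ + 1 → (∀ n m i → i ℕ.< n ℕ.+ m → T n m i ≡ + 0) →
  (∀ N → P ≐[ N ] p N) → (∀ N → diag (λ s _ → diag T s) (suc (double N)) *S p N ≐[ N ] oneS) → doubleSum T ≐ invS P
inverse-from-limits T P p P0 vanish P≐p limit = at (begin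
  S ≈⟨ *-identityʳ S ⟨
  S *S oneS ≈⟨ *-congˡ {S} {P *S invS P} {oneS} (by-coefficients (invS-inverse P P0)) ⟨
  S *S (P *S invS P) ≈⟨ *-assoc S P (invS P) ⟨
  S *S P *S invS P ≈⟨ *-congʳ S*P≋1 ⟩
  oneS *S invS P ≈⟨ *-identityˡ (invS P) ⟩
  invS P ∎)
  where
  open import Relation.Binary.Reasoning.Setoid setoid
  S = doubleSum T
  i≤1+2N : ∀ i N → i ℕ.< N → i ℕ.≤ suc (double N)
  i≤1+2N i N i<N = ℕₚ.m≤n⇒m≤1+n (ℕₚ.≤-trans (ℕₚ.<⇒≤ i<N) (≡.subst (N ℕ.≤_) (≡.sym (double≡+ N)) (ℕₚ.m≤m+n N N)))
  S*P≋1 : S *S P ≋ oneS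
  S*P≋1 = by-coefficients λ n → let N = suc n in ≡.trans (*S-≐[] {S} {diag (λ s _ → diag T s) (suc (double N))} {P} {p N}
      (λ i i<N → doubleSum-diagonal T vanish (i≤1+2N i N i<N)) (P≐p N) n ℕₚ.≤-refl) (limit N n ℕₚ.≤-refl)

term≋ : ∀ k e (f g : Series) → mono (sgn k) e *S f *S g ≋ ε ^ k *S t ^ e *S f *S g
term≋ k e f g = *-congʳ {g} {mono (sgn k) e *S f} {ε ^ k *S t ^ e *S f}
  (*-congʳ {f} {mono (sgn k) e} {ε ^ k *S t ^ e} (mono-sgn k e))

term-low : ∀ k e (f g : Series) i → i ℕ.< e → (mono (sgn k) e *S f *S g) i ≡ + 0
term-low k e f g i i<e = ≡.trans (_≋_.at (trans (term≋ k e f g)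
    (solve 4 (λ a b c d → a :* b :* c :* d := b :* (a :* c :* d)) refl (ε ^ k) (t ^ e) f g)) i)
  (t^*-low e (ε ^ k *S f *S g) i i<e)

n≤n² : ∀ n → n ℕ.≤ n ℕ.* n
n≤n² zero = ℕ.z≤n
n≤n² n@(suc _) = ℕₚ.m≤m*n n n

n+m≤E : ∀ n m {e} r → n ℕ.* n ℕ.+ m ℕ.* m ℕ.+ r ≡ e → n ℕ.+ m ℕ.≤ e
n+m≤E n m r ≡.refl = ℕₚ.≤-trans (ℕₚ.+-mono-≤ (n≤n² n) (n≤n² m)) (ℕₚ.m≤m+n _ r)

conclude : ∀ c (T T′ : ℕ → ℕ → Series) (P : Series) (p p′ : ℕ → Series) → P 0 ≡ + 1 →
  (∀ n m i → i ℕ.< n ℕ.+ m → T n m i ≡ + 0) → (∀ n m → T n m ≋ T′ n m) →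
  (∀ N → P ≐[ N ] p N) → (∀ N → p N ≋ p′ N) →
  (∀ N → Limits._≃[_]_ seriesRing (t ^ suc c) (diag (λ s _ → diag T′ s) (suc (double N)) *S p′ N) N oneS) →
  doubleSum T ≐ invS P
conclude c T T′ P p p′ P0 vanish T≋T′ P≐p p≋p′ limit = inverse-from-limits T P p P0 vanish P≐p λ N i i<N →
  ≡.trans (_≋_.at (*-cong {S T N} {S T′ N} {p N} {p′ N}
      (diag-cong (suc (double N)) λ s _ _ → diag-cong s λ n m _ → T≋T′ n m) (p≋p′ N)) i)
    (≃⇒≐[] c (limit N) i i<N)
  where
  S : (ℕ → ℕ → Series) → ℕ → Series
  S T N = diag (λ s _ → diag T s) (suc (double N))

open Identities t t-cancel (1/poch-reciprocal 3) (1/poch-reciprocal 7) (1/poch-reciprocal 15)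
  (1/poch-reciprocal 19) (1/poch-reciprocal 39)

two-products : ∀ a b s N → pochInf (+ 1) (suc a) (suc s) *S pochInf (+ 1) (suc b) (suc s)
  ≐[ N ] poch (+ 1) (suc a) (suc s) N *S poch (+ 1) (suc b) (suc s) N
two-products a b s N = *S-≐[] {pochInf (+ 1) (suc a) (suc s)} {poch (+ 1) (suc a) (suc s) N}
  (pochInf-≐[] (+ 1) a s N) (pochInf-≐[] (+ 1) b s N)

two-products≋ : ∀ a b s N → poch (+ 1) a s N *S poch (+ 1) b s N ≋ t ^ a ⨾ t ^ s ⟨ N ⟩ *S t ^ b ⨾ t ^ s ⟨ N ⟩
two-products≋ a b s N = *-cong {poch (+ 1) a s N} {t ^ a ⨾ t ^ s ⟨ N ⟩} {poch (+ 1) b s N} {t ^ b ⨾ t ^ s ⟨ N ⟩}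
  (poch⁺ a s N) (poch⁺ b s N)

three-products : ∀ a b s N → pochInf (ℤ.- + 1) 8 8 *S (pochInf (+ 1) (suc a) (suc s) *S pochInf (+ 1) (suc b) (suc s))
  ≐[ N ] poch (ℤ.- + 1) 8 8 N *S (poch (+ 1) (suc a) (suc s) N *S poch (+ 1) (suc b) (suc s) N)
three-products a b s N = *S-≐[] {pochInf (ℤ.- + 1) 8 8} {poch (ℤ.- + 1) 8 8 N}
  (pochInf-≐[] (ℤ.- + 1) 7 7 N) (two-products a b s N)

three-products≋ : ∀ a b s N → poch (ℤ.- + 1) 8 8 N *S (poch (+ 1) a s N *S poch (+ 1) b s N)
  ≋ negS (t ^ 8) ⨾ t ^ 8 ⟨ N ⟩ *S (t ^ a ⨾ t ^ s ⟨ N ⟩ *S t ^ b ⨾ t ^ s ⟨ N ⟩)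
three-products≋ a b s N = *-cong {poch (ℤ.- + 1) 8 8 N} {negS (t ^ 8) ⨾ t ^ 8 ⟨ N ⟩}
  {poch (+ 1) a s N *S poch (+ 1) b s N} {t ^ a ⨾ t ^ s ⟨ N ⟩ *S t ^ b ⨾ t ^ s ⟨ N ⟩}
  (poch⁻ 8 8 N) (two-products≋ a b s N)

lhs1≐rhs1 : lhs1 ≐ rhs1
lhs1≐rhs1 = conclude 7 _ (signed E₁) (pochInf (+ 1) 8 40 *S pochInf (+ 1) 32 40) _ _ ≡.refl
  (λ n m i i<n+m → term-low (binom2 (+ n ℤ.- + m)) (E₁ n m) (1/poch 4 m) (1/poch 4 n) i
    (ℕₚ.<-≤-trans i<n+m (n+m≤E n m _ (arith n m))))
  (λ n m → term≋ (binom2 (+ n ℤ.- + m)) (E₁ n m) (1/poch 4 m) (1/poch 4 n))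
  (two-products 7 31 39) (two-products≋ 8 32 40) identity₁
  where
  arith : ∀ n m → n ℕ.* n ℕ.+ m ℕ.* m ℕ.+ (2 ℕ.* m ℕ.* m ℕ.+ 2 ℕ.* m ℕ.* n ℕ.+ 2 ℕ.* n ℕ.* n)
    ≡ 3 ℕ.* m ℕ.* m ℕ.+ 2 ℕ.* m ℕ.* n ℕ.+ 3 ℕ.* n ℕ.* n
  arith = solve-∀

lhs2≐rhs2 : lhs2 ≐ rhs2
lhs2≐rhs2 = conclude 7 _ (signed E₂) (pochInf (+ 1) 16 40 *S pochInf (+ 1) 24 40) _ _ ≡.refl
  (λ n m i i<n+m → term-low (binom2 (+ n ℤ.- + m)) (E₂ n m) (1/poch 4 m) (1/poch 4 n) i
    (ℕₚ.<-≤-trans i<n+m (n+m≤E n m _ (arith n m))))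
  (λ n m → term≋ (binom2 (+ n ℤ.- + m)) (E₂ n m) (1/poch 4 m) (1/poch 4 n))
  (two-products 15 23 39) (two-products≋ 16 24 40) identity₂
  where
  arith : ∀ n m → n ℕ.* n ℕ.+ m ℕ.* m ℕ.+ (2 ℕ.* m ℕ.* m ℕ.+ 2 ℕ.* m ℕ.* n ℕ.+ 2 ℕ.* n ℕ.* n ℕ.+ 4 ℕ.* m ℕ.+ 4 ℕ.* n)
    ≡ 3 ℕ.* m ℕ.* m ℕ.+ 2 ℕ.* m ℕ.* n ℕ.+ 3 ℕ.* n ℕ.* n ℕ.+ 4 ℕ.* m ℕ.+ 4 ℕ.* n
  arith = solve-∀

lhs3≐rhs3 : lhs3 ≐ rhs3
lhs3≐rhs3 = conclude 3 _ (alternating E₃) (pochInf (ℤ.- + 1) 8 8 *S (pochInf (+ 1) 4 20 *S pochInf (+ 1) 16 20)) _ _ ≡.refl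
  (λ n m i i<n+m → term-low m (E₃ n m) (1/poch 8 m) (1/poch 8 n) i
    (ℕₚ.<-≤-trans i<n+m (n+m≤E n m _ (arith n m))))
  (λ n m → term≋ m (E₃ n m) (1/poch 8 m) (1/poch 8 n))
  (three-products 3 15 19) (three-products≋ 4 16 20) identity₃
  where
  arith : ∀ n m → n ℕ.* n ℕ.+ m ℕ.* m ℕ.+ 2 ℕ.* m ℕ.* n ≡ m ℕ.* m ℕ.+ 2 ℕ.* m ℕ.* n ℕ.+ n ℕ.* n
  arith = solve-∀

lhs4≐rhs4 : lhs4 ≐ rhs4
lhs4≐rhs4 = conclude 3 _ (alternating E₄) (pochInf (ℤ.- + 1) 8 8 *S (pochInf (+ 1) 8 20 *S pochInf (+ 1) 12 20)) _ _ ≡.refl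
  (λ n m i i<n+m → term-low m (E₄ n m) (1/poch 8 m) (1/poch 8 n) i
    (ℕₚ.<-≤-trans i<n+m (n+m≤E n m _ (arith n m))))
  (λ n m → term≋ m (E₄ n m) (1/poch 8 m) (1/poch 8 n))
  (three-products 7 11 19) (three-products≋ 8 12 20) identity₄
  where
  arith : ∀ n m → n ℕ.* n ℕ.+ m ℕ.* m ℕ.+ (2 ℕ.* m ℕ.* n ℕ.+ 4 ℕ.* m ℕ.+ 4 ℕ.* n)
    ≡ m ℕ.* m ℕ.+ 2 ℕ.* m ℕ.* n ℕ.+ n ℕ.* n ℕ.+ 4 ℕ.* m ℕ.+ 4 ℕ.* n
  arith = solve-∀

theorem1p1 : (lhs1 ≐ rhs1) × (lhs2 ≐ rhs2) × (lhs3 ≐ rhs3) × (lhs4 ≐ rhs4)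
theorem1p1 = lhs1≐rhs1 , lhs2≐rhs2 , lhs3≐rhs3 , lhs4≐rhs4
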